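{- For each positive integer $n$, let $G_n\sim G(n,1/2)$ be the random graph on vertex set $[n]=\{1,\dots,n\}$ in which each of the $\binom n2$ pairs is an edge independently with probability $1/2$. Then, as $n\to\infty$, the probability that $G_n$ satisfies the token graph reconstruction conjecture tends to $1$. That is, the probability of the event that for every integer $k$ with $1\le k<n$ and every finite graph $H$, $F_k(G_n)\cong F_k(H)$ implies $G_n\cong H$, tends to $1$ as $n\to\infty$.
   Context: All graphs are finite, simple and undirected; edges are regarded as 2-element subsets of the vertex set. For a graph $G$ and an integer $k$ with $1\le k<|V(G)|$, the $k$-token graph $F_k(G)$ is the graph whose vertices are the $k$-element subsets of $V(G)$, with two such subsets $A,B$ adjacent if and only if their symmetric difference $A\triangle B$ is an edge of $G$ (in particular $|A\triangle B|=2$). A graph $G$ is said to satisfy the token graph reconstruction conjecture if for every integer $k$ with $1\le k<|V(G)|$ and every finite graph $H$ (for which $F_k(H)$ is defined, i.e. $k<|V(H)|$), $F_k(G)\cong F_k(H)$ implies $G\cong H$. Here $H$ is not assumed to have the same number of vertices as $G$. -}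

module Defs where

open import Data.Bool.Base using (Bool; true; false; T)
open import Data.Bool.Properties using (T?)
open import Data.Empty using (⊥-elim)
open import Data.Fin.Base using (Fin; zero; suc; finToFun; funToFin)
open import Data.Fin.Properties as Fin
  using (any?; all?; +↔⊎; finToFun-funToFin)
open import Data.Fin.Subset
  using (Subset; inside; outside; ∣_∣; ⁅_⁆; _∪_; _─_; _∈_; ⊥)
open import Data.Fin.Subset.Properties using (∪-comm; ∉⊥; x∈⁅x⁆; p⊆p∪q)
open import Data.Fin.Permutation using (↔⇒≡)
open import Data.List.Base as List using (List; []; _∷_)
open import Data.Nat.Base as ℕ using (ℕ; zero; suc; z≤n; s≤s)
open import Data.Nat.Properties as ℕ using ()
open import Data.Product.Base
  using (Σ; ∃; ∃₂; _×_; _,_; proj₁; proj₂; uncurry)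
open import Data.Rational.Base as ℚ using (ℚ; 0ℚ; 1ℚ; ½)
open import Data.Sum.Base using (_⊎_; inj₁; inj₂)
open import Data.Sum.Function.Propositional using (_⊎-↔_)
open import Data.Vec.Base using (Vec; []; _∷_; lookup; tabulate)
open import Data.Vec.Properties using (≡-dec; lookup∘tabulate)
import Data.Bool.Properties as Bool
open import Function.Base using (_∘_)
open import Function.Bundles
  using (_↔_; _⇔_; mk↔ₛ′; mk⇔; module Inverse; module Equivalence)
open import Function.Construct.Symmetry using (⇔-sym)
open import Function.Properties.Inverse using (↔-refl; ↔-sym; ↔-trans)
open import Level using (Level; 0ℓ)
open import Relation.Binary.Core using (Rel)
open import Relation.Binary.Definitions
  using (Symmetric; Irreflexive; Decidable)
open import Relation.Binary.PropositionalEquality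
  using (_≡_; refl; sym; trans; cong; subst; subst₂)
open import Relation.Nullary.Decidable
  using (Dec; yes; no; isYes; map′; _×-dec_; _→-dec_; toWitness; fromWitness)
open import Relation.Nullary.Negation using (¬_)
open import Relation.Unary using (Pred) renaming (Decidable to Decidable₁)

private
  variable
    ℓ ℓ′ : Level
    V W X : Set
    m n k : ℕ

------------------------------------------------------------------------
-- Graphs

-- adj? holds of every graph classically; here it makes the edge set a
-- genuine (decidable) set of pairs.
record Graph (V : Set) : Set₁ where
  field
    Adj    : Rel V 0ℓ
    adj?   : Decidable Adj
    symm   : Symmetric Adj
    irrefl : Irreflexive _≡_ Adj

open Graph public

infix 4 _≅_

record _≅_ (G : Graph V) (H : Graph W) : Set where
  field
    bij      : V ↔ W
    preserve : ∀ u v → Adj G u v ⇔ Adj H (Inverse.to bij u) (Inverse.to bij v)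

open _≅_ public

------------------------------------------------------------------------
-- Token graphs

infixl 6 _△_

_△_ : Subset n → Subset n → Subset n
A △ B = (A ─ B) ∪ (B ─ A)

KSubset : ℕ → ℕ → Set
KSubset n k = Σ (Subset n) λ A → ∣ A ∣ ≡ k

-- The set S, viewed as a set of vertices, is an edge {u , v} of G.
IsEdge : Graph (Fin n) → Subset n → Set
IsEdge G S = ∃₂ λ u v → Adj G u v × S ≡ ⁅ u ⁆ ∪ ⁅ v ⁆

isEdge? : (G : Graph (Fin n)) → Decidable₁ (IsEdge G)
isEdge? G S =
  any? λ u → any? λ v → adj? G u v ×-dec ≡-dec Bool._≟_ S (⁅ u ⁆ ∪ ⁅ v ⁆)

△-self : (A : Subset n) → A △ A ≡ ⊥
△-self []            = refl
△-self (inside  ∷ A) = cong (outside ∷_) (△-self A)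
△-self (outside ∷ A) = cong (outside ∷_) (△-self A)

⊥-notEdge : (G : Graph (Fin n)) {S : Subset n} → S ≡ ⊥ → ¬ IsEdge G S
⊥-notEdge G S≡⊥ (u , v , _ , S≡uv) =
  ∉⊥ (subst (u ∈_) (trans (sym S≡uv) S≡⊥) (p⊆p∪q ⁅ v ⁆ (x∈⁅x⁆ u)))

-- Total in k; the hypotheses 1 ≤ k < |V(G)| are imposed where it is used.
tokenGraph : (k : ℕ) → Graph (Fin n) → Graph (KSubset n k)
tokenGraph k G = record
  { Adj    = λ A B → IsEdge G (proj₁ A △ proj₁ B)
  ; adj?   = λ A B → isEdge? G (proj₁ A △ proj₁ B)
  ; symm   = λ {A} {B} →
      subst (IsEdge G) (∪-comm (proj₁ A ─ proj₁ B) (proj₁ B ─ proj₁ A))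
  ; irrefl = λ { {A} refl → ⊥-notEdge G (△-self (proj₁ A)) }
  }

-- Up to isomorphism every finite graph has vertex set Fin m for some m.
SatisfiesTRC : Graph (Fin n) → Set₁
SatisfiesTRC {n} G =
  ∀ k → 1 ℕ.≤ k → k ℕ.< n →
  ∀ m (H : Graph (Fin m)) → k ℕ.< m →
  tokenGraph k G ≅ tokenGraph k H → G ≅ H

------------------------------------------------------------------------
-- Finitely supported probability distributions

-- A list of outcomes with their weights; an outcome may be repeated.
Dist : Set ℓ → Set ℓ
Dist A = List (ℚ × A)

mapDist : {A : Set ℓ} {B : Set ℓ′} → (A → B) → Dist A → Dist B
mapDist f = List.map λ (p , a) → p , f a

-- The joint distribution of two independent random elements.
_⊗_ : {A : Set ℓ} {B : Set ℓ′} → Dist A → Dist B → Dist (A × B)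
_⊗_ = List.cartesianProductWith λ (p , a) (q , b) → p ℚ.* q , (a , b)

Pr : {A : Set ℓ} → Dist A → {P : Pred A ℓ′} → Decidable₁ P → ℚ
Pr d P? =
  List.foldr ℚ._+_ 0ℚ (List.map proj₁ (List.filter (λ (_ , a) → P? a) d))

fairCoin : Dist Bool
fairCoin = (½ , true) ∷ (½ , false) ∷ []

fairCoins : (n : ℕ) → Dist (Vec Bool n)
fairCoins zero    = (1ℚ , []) ∷ []
fairCoins (suc n) = mapDist (uncurry _∷_) (fairCoin ⊗ fairCoins n)

------------------------------------------------------------------------
-- The random graph G(n,1/2)

-- One bit for every pair i < j in Fin n: the first row holds the bits
-- of the pairs {zero , suc j}, and the remaining rows those of the
-- pairs {suc i , suc j}.
data EdgeBits : ℕ → Set where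
  []  : EdgeBits zero
  _∷_ : Vec Bool n → EdgeBits n → EdgeBits (suc n)

bit : EdgeBits n → Fin n → Fin n → Bool
bit (row ∷ ω) zero    zero    = false
bit (row ∷ ω) zero    (suc j) = lookup row j
bit (row ∷ ω) (suc i) zero    = lookup row i
bit (row ∷ ω) (suc i) (suc j) = bit ω i j

bit-sym : (ω : EdgeBits n) → ∀ i j → bit ω i j ≡ bit ω j i
bit-sym (row ∷ ω) zero    zero    = refl
bit-sym (row ∷ ω) zero    (suc j) = refl
bit-sym (row ∷ ω) (suc i) zero    = refl
bit-sym (row ∷ ω) (suc i) (suc j) = bit-sym ω i j

bit-irrefl : (ω : EdgeBits n) → ∀ i → bit ω i i ≡ false
bit-irrefl (row ∷ ω) zero    = refl
bit-irrefl (row ∷ ω) (suc i) = bit-irrefl ω i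

toGraph : EdgeBits n → Graph (Fin n)
toGraph ω = record
  { Adj    = λ i j → T (bit ω i j)
  ; adj?   = λ i j → T? (bit ω i j)
  ; symm   = λ {i} {j} → subst T (bit-sym ω i j)
  ; irrefl = λ { {i} refl → subst T (bit-irrefl ω i) }
  }

fairEdgeBits : (n : ℕ) → Dist (EdgeBits n)
fairEdgeBits zero    = (1ℚ , []) ∷ []
fairEdgeBits (suc n) = mapDist (uncurry _∷_) (fairCoins n ⊗ fairEdgeBits n)

randomGraph : (n : ℕ) → Dist (Graph (Fin n))
randomGraph n = mapDist toGraph (fairEdgeBits n)

------------------------------------------------------------------------
-- Limits

TendsTo : (ℕ → ℚ) → ℚ → Set
TendsTo a L =
  ∀ ε → 0ℚ ℚ.< ε → ∃ λ N → ∀ n → N ℕ.≤ n → ℚ.∣ a n ℚ.- L ∣ ℚ.< ε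

------------------------------------------------------------------------
-- SatisfiesTRC is decidable, so that it is an event with a probability
-- in the sense of Pr. (Isomorphism of finite graphs is decidable, and
-- F_k(G) ≅ F_k(H) bounds the number of vertices of H.)

≅-sym : {G : Graph V} {H : Graph W} → G ≅ H → H ≅ G
≅-sym {H = H} i = record
  { bij      = ↔-sym (bij i)
  ; preserve = λ x y → ⇔-sym
      (subst₂ (λ x′ y′ → _ ⇔ Adj H x′ y′)
        (Inverse.strictlyInverseˡ (bij i) x) (Inverse.strictlyInverseˡ (bij i) y)
        (preserve i (Inverse.from (bij i) x) (Inverse.from (bij i) y)))
  }

≅-trans : {G : Graph V} {H : Graph W} {K : Graph X} → G ≅ H → H ≅ K → G ≅ K
≅-trans i j = record
  { bij      = ↔-trans (bij i) (bij j)
  ; preserve = λ u v → mk⇔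
      (Equivalence.to (preserve j _ _) ∘ Equivalence.to (preserve i u v))
      (Equivalence.from (preserve i u v) ∘ Equivalence.from (preserve j _ _))
  }

transport : V ↔ W → Graph V → Graph W
transport e G = record
  { Adj    = λ x y → Adj G (from x) (from y)
  ; adj?   = λ x y → adj? G (from x) (from y)
  ; symm   = symm G
  ; irrefl = λ { refl → irrefl G refl }
  }
  where open Inverse e

transport-≅ : (e : V ↔ W) (G : Graph V) → transport e G ≅ G
transport-≅ e G = record
  { bij = ↔-sym e ; preserve = λ _ _ → mk⇔ (λ p → p) (λ p → p) }

module _ (G : Graph (Fin m)) (H : Graph (Fin n)) where

  private
    IsIso : (Fin m → Fin n) → (Fin n → Fin m) → Set
    IsIso f g =
      (∀ y → f (g y) ≡ y) × (∀ x → g (f x) ≡ x) ×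
      (∀ u v → (Adj G u v → Adj H (f u) (f v)) × (Adj H (f u) (f v) → Adj G u v))

    isIso? : ∀ f g → Dec (IsIso f g)
    isIso? f g =
      all? (λ y → f (g y) Fin.≟ y) ×-dec
      all? (λ x → g (f x) Fin.≟ x) ×-dec
      all? λ u → all? λ v →
        (adj? G u v →-dec adj? H (f u) (f v)) ×-dec
        (adj? H (f u) (f v) →-dec adj? G u v)

    isIso-resp : ∀ {f f′ g g′} → (∀ x → f′ x ≡ f x) → (∀ y → g′ y ≡ g y) →
                 IsIso f g → IsIso f′ g′
    isIso-resp {f} {f′} {g} {g′} f≗ g≗ (fg , gf , pres) =
      (λ y → trans (f≗ (g′ y)) (trans (cong f (g≗ y)) (fg y))) ,
      (λ x → trans (g≗ (f′ x)) (trans (cong g (f≗ x)) (gf x))) ,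
      λ u v → subst₂ (λ a b → (Adj G u v → Adj H a b) × (Adj H a b → Adj G u v))
                (sym (f≗ u)) (sym (f≗ v)) (pres u v)

  isoFin? : Dec (G ≅ H)
  isoFin? = map′
    (λ (_ , _ , fg , gf , pres) → record
      { bij      = mk↔ₛ′ _ _ fg gf
      ; preserve = λ u v → mk⇔ (proj₁ (pres u v)) (proj₂ (pres u v)) })
    (λ i → let open Inverse (bij i) in
      funToFin to , funToFin from ,
      isIso-resp (finToFun-funToFin to) (finToFun-funToFin from)
        ( strictlyInverseˡ , strictlyInverseʳ
        , λ u v → Equivalence.to (preserve i u v) , Equivalence.from (preserve i u v)))
    (any? λ c → any? λ d → isIso? (finToFun c) (finToFun d))

≅? : V ↔ Fin m → W ↔ Fin n → (G : Graph V) (H : Graph W) → Dec (G ≅ H)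
≅? e f G H = map′
  (λ i → ≅-trans (≅-sym (transport-≅ e G)) (≅-trans i (transport-≅ f H)))
  (λ i → ≅-trans (transport-≅ e G) (≅-trans i (≅-sym (transport-≅ f H))))
  (isoFin? (transport e G) (transport f H))

binom : ℕ → ℕ → ℕ
binom zero    zero    = 1
binom zero    (suc k) = 0
binom (suc n) zero    = binom n zero
binom (suc n) (suc k) = binom n k ℕ.+ binom n (suc k)

KSubset-≡ : {A B : KSubset n k} → proj₁ A ≡ proj₁ B → A ≡ B
KSubset-≡ {A = A , p} {B = .A , q} refl = cong (A ,_) (ℕ.≡-irrelevant p q)

KSubset-zero : KSubset (suc n) zero ↔ KSubset n zero
KSubset-zero = mk↔ₛ′
  (λ { (outside ∷ A , p) → A , p ; (inside ∷ A , ()) })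
  (λ (A , p) → outside ∷ A , p)
  (λ _ → refl)
  (λ { (outside ∷ A , p) → refl ; (inside ∷ A , ()) })

KSubset-suc : KSubset (suc n) (suc k) ↔ (KSubset n k ⊎ KSubset n (suc k))
KSubset-suc = mk↔ₛ′
  (λ { (inside ∷ A , p) → inj₁ (A , ℕ.suc-injective p)
     ; (outside ∷ A , p) → inj₂ (A , p) })
  (λ { (inj₁ (A , p)) → inside ∷ A , cong suc p
     ; (inj₂ (A , p)) → outside ∷ A , p })
  (λ { (inj₁ _) → cong inj₁ (KSubset-≡ refl) ; (inj₂ _) → refl })
  (λ { (inside ∷ A , p) → KSubset-≡ refl ; (outside ∷ A , p) → refl })

KSubset↔Fin : ∀ n k → KSubset n k ↔ Fin (binom n k)
KSubset↔Fin zero zero = mk↔ₛ′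
  (λ _ → zero) (λ _ → [] , refl) (λ { zero → refl })
  (λ { ([] , p) → KSubset-≡ refl })
KSubset↔Fin zero (suc k) = mk↔ₛ′
  (λ { ([] , ()) }) (λ ()) (λ ()) (λ { ([] , ()) })
KSubset↔Fin (suc n) zero = ↔-trans KSubset-zero (KSubset↔Fin n zero)
KSubset↔Fin (suc n) (suc k) = ↔-trans KSubset-suc
  (↔-trans (KSubset↔Fin n k ⊎-↔ KSubset↔Fin n (suc k)) (↔-sym +↔⊎))

binom>0 : ∀ n k → k ℕ.≤ n → 1 ℕ.≤ binom n k
binom>0 zero    zero    z≤n     = s≤s z≤n
binom>0 (suc n) zero    z≤n     = binom>0 n zero z≤n
binom>0 (suc n) (suc k) (s≤s p) = ℕ.≤-trans (binom>0 n k p) (ℕ.m≤m+n _ _)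

binom-pred : ∀ k → suc k ℕ.≤ binom (suc k) k
binom-pred zero    = s≤s z≤n
binom-pred (suc k) = subst (ℕ._≤ binom (2 ℕ.+ k) (1 ℕ.+ k)) (ℕ.+-comm (suc k) 1)
  (ℕ.+-mono-≤ (binom-pred k) (binom>0 (suc k) (suc k) ℕ.≤-refl))

binom-bound : ∀ m k → 1 ℕ.≤ k → k ℕ.< m → m ℕ.≤ binom m k
binom-bound (suc m) (suc k) 1≤k (s≤s 1+k≤m) with ℕ.m≤n⇒m<n∨m≡n 1+k≤m
... | inj₁ 1+k<m = ℕ.+-mono-≤ (binom>0 m k (ℕ.<⇒≤ 1+k≤m))
                              (binom-bound m (suc k) 1≤k 1+k<m)
... | inj₂ refl  = binom-pred (suc k)

allBits? : ∀ n {P : Pred (Vec Bool n) ℓ} → Decidable₁ P → Dec (∀ v → P v)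
allBits? zero    P? = map′ (λ { p [] → p }) (λ p → p []) (P? [])
allBits? (suc n) P? = map′
  (λ { (t , f) (true ∷ v) → t v ; (t , f) (false ∷ v) → f v })
  (λ p → (λ v → p (true ∷ v)) , (λ v → p (false ∷ v)))
  (allBits? n (P? ∘ (true ∷_)) ×-dec allBits? n (P? ∘ (false ∷_)))

allEdgeBits? : ∀ n {P : Pred (EdgeBits n) ℓ} → Decidable₁ P → Dec (∀ ω → P ω)
allEdgeBits? zero    P? = map′ (λ { p [] → p }) (λ p → p []) (P? [])
allEdgeBits? (suc n) P? = map′
  (λ { p (row ∷ ω) → p row ω })
  (λ p row ω → p (row ∷ ω))
  (allBits? n λ row → allEdgeBits? n λ ω → P? (row ∷ ω))

fromGraph : Graph (Fin n) → EdgeBits n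
fromGraph {zero}  G = []
fromGraph {suc n} G =
  tabulate (λ j → isYes (adj? G zero (suc j))) ∷ fromGraph (record
    { Adj    = λ i j → Adj G (suc i) (suc j)
    ; adj?   = λ i j → adj? G (suc i) (suc j)
    ; symm   = symm G
    ; irrefl = λ { refl → irrefl G refl }
    })

bit-fromGraph : (G : Graph (Fin n)) → ∀ i j →
                Adj G i j ⇔ T (bit (fromGraph G) i j)
bit-fromGraph G zero    zero    =
  mk⇔ (λ a → ⊥-elim (irrefl G refl a)) (λ ())
bit-fromGraph G zero    (suc j)
  rewrite lookup∘tabulate (λ j → isYes (adj? G zero (suc j))) j =
  mk⇔ fromWitness toWitness
bit-fromGraph G (suc i) zero
  rewrite lookup∘tabulate (λ j → isYes (adj? G zero (suc j))) i =
  mk⇔ (fromWitness ∘ symm G) (symm G ∘ toWitness)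
bit-fromGraph G (suc i) (suc j) = bit-fromGraph (record
    { Adj    = λ i j → Adj G (suc i) (suc j)
    ; adj?   = λ i j → adj? G (suc i) (suc j)
    ; symm   = symm G
    ; irrefl = λ { refl → irrefl G refl }
    }) i j

fromGraph-≅ : (G : Graph (Fin n)) → G ≅ toGraph (fromGraph G)
fromGraph-≅ G = record { bij = ↔-refl ; preserve = bit-fromGraph G }

token-fromGraph-≅ : ∀ k (G : Graph (Fin n)) →
                    tokenGraph k G ≅ tokenGraph k (toGraph (fromGraph G))
token-fromGraph-≅ k G = record
  { bij      = ↔-refl
  ; preserve = λ _ _ → mk⇔
      (λ (u , v , a , e) → u , v , Equivalence.to (bit-fromGraph G u v) a , e)
      (λ (u , v , a , e) → u , v , Equivalence.from (bit-fromGraph G u v) a , e)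
  }

satisfiesTRC? : Decidable₁ (SatisfiesTRC {n})
satisfiesTRC? {n} G = map′
  (λ f k 1≤k k<n → f k<n 1≤k) (λ f {k} k<n 1≤k → f k 1≤k k<n)
  (ℕ.allUpTo? forK? n)
  where
  ForM : ℕ → ℕ → Set₁
  ForM k m = (H : Graph (Fin m)) → k ℕ.< m →
             tokenGraph k G ≅ tokenGraph k H → G ≅ H

  ForK : ℕ → Set₁
  ForK k = 1 ℕ.≤ k → ∀ m → ForM k m

  forM? : ∀ k m → Dec (ForM k m)
  forM? k m = map′
    (λ f H k<m i → ≅-trans
      (f (fromGraph H) k<m (≅-trans i (token-fromGraph-≅ k H)))
      (≅-sym (fromGraph-≅ H)))
    (λ f ω → f (toGraph ω))
    (allEdgeBits? m λ ω → (k ℕ.<? m) →-dec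
      ≅? (KSubset↔Fin n k) (KSubset↔Fin m k) (tokenGraph k G) (tokenGraph k (toGraph ω))
      →-dec isoFin? G (toGraph ω))

  size : ∀ {k m} {H : Graph (Fin m)} →
         tokenGraph k G ≅ tokenGraph k H → binom n k ≡ binom m k
  size {k} {m} i =
    ↔⇒≡ (↔-trans (↔-sym (KSubset↔Fin n k)) (↔-trans (bij i) (KSubset↔Fin m k)))

  forK? : ∀ k → Dec (ForK k)
  forK? k with 1 ℕ.≤? k
  ... | no  1≰k = yes λ 1≤k → ⊥-elim (1≰k 1≤k)
  ... | yes 1≤k = map′
    (λ f _ m H k<m i → f
      (s≤s (subst (m ℕ.≤_) (sym (size {H = H} i)) (binom-bound m k 1≤k k<m)))
      H k<m i)
    (λ f {m} _ → f 1≤k m)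
    (ℕ.allUpTo? (forM? k) (suc (binom n k)))

{-# OPTIONS --safe #-}

-- If every two vertices of G have at least five common neighbours, then G
-- can be recovered from F_k(G). Two k-sets at distance 2 in the Johnson graph
-- J(n,k) have at most four common neighbours there, hence at most four in any
-- token graph, while k-sets differing in u and v have codeg(u,v) ≥ 5 common
-- neighbours in F_k(G). So an isomorphism φ : F_k(G) → F_k(H), where |V(H)| = n
-- because n ↦ C(n,k) is injective for n ≥ k ≥ 1, preserves adjacency in J(n,k),
-- and also reflects it, the vertex set being finite. The neighbourhood of a
-- k-set A in J(n,k) is a k × (n - k) grid in which two cells are adjacent when
-- they share a line; an isomorphism of such grids permutes rows and columns,
-- possibly after a transposition. Hence there is a permutation π with
-- φ(A △ {a,b}) = φ(A) △ {π(a),π(b)} for all a ∈ A and b ∉ A, and this alone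
-- makes π an isomorphism G → H, since every pair of vertices is the symmetric
-- difference of two sets among A and its neighbours.
--
-- In G(n,1/2) the codegree of two vertices is binomial with parameters n - 2
-- and 1/4, so that E[2^-codeg] = (7/8)^(n-2), and by Markov's inequality and
-- the union bound some codegree is less than 5 with probability at most
-- 16 n² (7/8)^(n-2).

module Submission where

open import Defs
open import Data.Rational.Base using (1ℚ)

open import Algebra.Bundles using (module CommutativeRing)
import Algebra.Definitions.RawSemiring as RawSemiringDefinitions
import Algebra.Properties.Semiring.Mult as SemiringMult
open import Axiom.UniquenessOfIdentityProofs using (module Decidable⇒UIP)
open import Data.Bool.Base using (Bool; true; false; not; _∧_; _∨_; _xor_; if_then_else_; T)
import Data.Bool.Properties as Bool
open import Data.Empty using (⊥-elim)
open import Data.Fin.Base using (Fin; zero; suc; toℕ; fromℕ<)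
open import Data.Fin.Patterns using (0F; 1F; 2F; 3F)
open import Data.Fin.Permutation using (↔⇒≡)
open import Data.Fin.Properties using (_≟_; any?; pigeonhole; suc-injective; *↔×)
open import Data.Fin.Subset using (Subset; ∣_∣; ⁅_⁆; _∪_; _∩_; ∁; ⊥)
open import Data.Fin.Subset.Properties using (∪-comm; ∩-comm; ∣∁p∣≡n∸∣p∣)
open import Data.Integer.Base as ℤ using (-[1+_])
import Data.Integer.Properties as ℤ
open import Data.List.Base as List using ([]; _∷_; _++_; foldr)
open import Data.Nat.Base as ℕ using (ℕ; zero; suc; z≤n; s≤s)
import Data.Nat.Properties as ℕ
open import Data.Nat.Solver using () renaming (module +-*-Solver to ℕ-Solver)
open import Data.Product.Base using (Σ; ∃; ∃₂; _×_; _,_; proj₁; proj₂; uncurry)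
open import Data.Product.Function.NonDependent.Propositional using (_×-↔_)
open import Data.Rational.Base as ℚ using (ℚ; 0ℚ; ½; _+_; _*_; _-_; _≤_; _<_; mkℚ; _/_)
import Data.Rational.Properties as ℚ
open import Data.Rational.Solver using () renaming (module +-*-Solver to ℚ-Solver)
open import Data.Rational.Unnormalised.Base as ℚᵘ using (mkℚᵘ; *≡*; *≤*)
import Data.Rational.Unnormalised.Properties as ℚᵘ
open import Data.Sum.Base as Sum using (_⊎_; inj₁; inj₂; [_,_]′)
open import Data.Unit.Base using (tt)
open import Data.Vec.Base using (Vec; []; _∷_; lookup; tabulate; zipWith)
open import Data.Vec.Properties
  using (≡-dec; lookup-zipWith; lookup-map; lookup-replicate; tabulate∘lookup; tabulate-cong)
open import Function.Base using (_∘_; case_of_)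
open import Function.Bundles
  using (_↔_; _⇔_; mk⇔; mk↔ₛ′; module Injection; module Inverse; module Equivalence)
open import Function.Definitions using (Injective)
open import Function.Properties.Inverse using (↔-refl; ↔-sym; ↔-trans; ↔⇒↣)
open import Level using (Level)
open import Relation.Binary.Definitions using (DecidableEquality; tri<; tri≈; tri>)
open import Relation.Binary.PropositionalEquality
open import Relation.Nullary.Decidable
  using (Dec; yes; no; does; map′; decidable-stable; ¬?; _×-dec_)
open import Relation.Nullary.Negation using (¬_; contradiction)
open import Relation.Unary using (Pred) renaming (Decidable to Decidable₁)

open RawSemiringDefinitions ℚ.+-*-rawSemiring using (_^_; sum) renaming (_×_ to _×ℚ_)

private
  variable
    a b p : Level
    X : Set a
    Y : Set b
    n k : ℕ

-- Subsets as vectors over the field with two elements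

true≢false : ∀ {b} → b ≡ true → b ≢ false
true≢false refl ()

lookup-ext : {A B : Subset n} → (∀ x → lookup A x ≡ lookup B x) → A ≡ B
lookup-ext {A = A} {B} A≗B = begin
  A                                 ≡⟨ tabulate∘lookup A ⟨
  tabulate (lookup A) ≡⟨ tabulate-cong A≗B ⟩
  tabulate (lookup B) ≡⟨ tabulate∘lookup B ⟩
  B                                 ∎
  where open ≡-Reasoning

△≡zipWith-xor : (A B : Subset n) → A △ B ≡ zipWith _xor_ A B
△≡zipWith-xor []          []          = refl
△≡zipWith-xor (true ∷ A)  (true ∷ B)  = cong (false ∷_) (△≡zipWith-xor A B)
△≡zipWith-xor (true ∷ A)  (false ∷ B) = cong (true ∷_)  (△≡zipWith-xor A B)
△≡zipWith-xor (false ∷ A) (true ∷ B)  = cong (true ∷_)  (△≡zipWith-xor A B)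
△≡zipWith-xor (false ∷ A) (false ∷ B) = cong (false ∷_) (△≡zipWith-xor A B)

lookup-△ : ∀ (A B : Subset n) x → lookup (A △ B) x ≡ lookup A x xor lookup B x
lookup-△ A B x =
  trans (cong (λ S → lookup S x) (△≡zipWith-xor A B)) (lookup-zipWith _xor_ x A B)

△-comm : (A B : Subset n) → A △ B ≡ B △ A
△-comm A B = ∪-comm _ _

△-assoc : (A B C : Subset n) → (A △ B) △ C ≡ A △ (B △ C)
△-assoc A B C = lookup-ext λ x → begin
  lookup ((A △ B) △ C) x                       ≡⟨ lookup-△ (A △ B) C x ⟩
  lookup (A △ B) x xor lookup C x              ≡⟨ cong (_xor lookup C x) (lookup-△ A B x) ⟩
  (lookup A x xor lookup B x) xor lookup C x   ≡⟨ Bool.xor-assoc (lookup A x) _ _ ⟩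
  lookup A x xor (lookup B x xor lookup C x)   ≡⟨ cong (lookup A x xor_) (lookup-△ B C x) ⟨
  lookup A x xor lookup (B △ C) x              ≡⟨ lookup-△ A (B △ C) x ⟨
  lookup (A △ (B △ C)) x                       ∎
  where open ≡-Reasoning

△-identityˡ : (A : Subset n) → ⊥ △ A ≡ A
△-identityˡ A = lookup-ext λ x →
  trans (lookup-△ ⊥ A x) (cong (_xor lookup A x) (lookup-replicate x false))

△-identityʳ : (A : Subset n) → A △ ⊥ ≡ A
△-identityʳ A = trans (△-comm A ⊥) (△-identityˡ A)

△-involutive : (A B : Subset n) → A △ (A △ B) ≡ B
△-involutive A B = begin
  A △ (A △ B) ≡⟨ △-assoc A A B ⟨
  (A △ A) △ B ≡⟨ cong (_△ B) (△-self A) ⟩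
  ⊥ △ B       ≡⟨ △-identityˡ B ⟩
  B           ∎
  where open ≡-Reasoning

△-solve : {A B P : Subset n} → A △ B ≡ P → B ≡ A △ P
△-solve {A = A} {B} refl = sym (△-involutive A B)

△-injective : {A B C : Subset n} → A △ B ≡ A △ C → B ≡ C
△-injective {A = A} {C = C} eq = trans (△-solve eq) (△-involutive A C)

-- Under `△` the subsets form a group in which every element is its own inverse, so a common
-- translation cancels.
△-translate : (A P Q : Subset n) → (A △ P) △ (A △ Q) ≡ P △ Q
△-translate A P Q = begin
  (A △ P) △ (A △ Q) ≡⟨ cong (_△ (A △ Q)) (△-comm A P) ⟩
  (P △ A) △ (A △ Q) ≡⟨ △-assoc P A (A △ Q) ⟩
  P △ (A △ (A △ Q)) ≡⟨ cong (P △_) (△-involutive A Q) ⟩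
  P △ Q             ∎
  where open ≡-Reasoning

△-path : (A B C : Subset n) → A △ B ≡ (A △ C) △ (B △ C)
△-path A B C = sym (begin
  (A △ C) △ (B △ C) ≡⟨ cong₂ _△_ (△-comm A C) (△-comm B C) ⟩
  (C △ A) △ (C △ B) ≡⟨ △-translate C A B ⟩
  A △ B             ∎)
  where open ≡-Reasoning

⁅⁆-same : (u : Fin n) → lookup ⁅ u ⁆ u ≡ true
⁅⁆-same zero    = refl
⁅⁆-same (suc u) = ⁅⁆-same u

⁅⁆-diff : {u x : Fin n} → x ≢ u → lookup ⁅ u ⁆ x ≡ false
⁅⁆-diff {u = zero}  {zero}  x≢u = ⊥-elim (x≢u refl)
⁅⁆-diff {u = zero}  {suc x} x≢u = lookup-replicate x false
⁅⁆-diff {u = suc u} {zero}  x≢u = refl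
⁅⁆-diff {u = suc u} {suc x} x≢u = ⁅⁆-diff (x≢u ∘ cong suc)

opaque
  -- This is {u , v} if u ≢ v, and empty otherwise.
  pair : Fin n → Fin n → Subset n
  pair u v = ⁅ u ⁆ △ ⁅ v ⁆

opaque
  unfolding pair

  pair-comm : (u v : Fin n) → pair u v ≡ pair v u
  pair-comm u v = △-comm ⁅ u ⁆ ⁅ v ⁆

  ∈-pairˡ : {u v : Fin n} → u ≢ v → lookup (pair u v) u ≡ true
  ∈-pairˡ {u = u} {v} u≢v =
    trans (lookup-△ ⁅ u ⁆ ⁅ v ⁆ u) (cong₂ _xor_ (⁅⁆-same u) (⁅⁆-diff u≢v))

  ∈-pairʳ : {u v : Fin n} → u ≢ v → lookup (pair u v) v ≡ true
  ∈-pairʳ {u = u} {v} u≢v =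
    trans (cong (λ S → lookup S v) (pair-comm u v)) (∈-pairˡ (u≢v ∘ sym))

  ∉-pair : {u v x : Fin n} → x ≢ u → x ≢ v → lookup (pair u v) x ≡ false
  ∉-pair {u = u} {v} {x} x≢u x≢v =
    trans (lookup-△ ⁅ u ⁆ ⁅ v ⁆ x) (cong₂ _xor_ (⁅⁆-diff x≢u) (⁅⁆-diff x≢v))

  pair-elim : {u v x : Fin n} → lookup (pair u v) x ≡ true → x ≡ u ⊎ x ≡ v
  pair-elim {u = u} {v} {x} x∈ with x ≟ u | x ≟ v
  ... | yes x≡u | _       = inj₁ x≡u
  ... | no _    | yes x≡v = inj₂ x≡v
  ... | no x≢u  | no x≢v  = ⊥-elim (true≢false x∈ (∉-pair x≢u x≢v))

  pair≢⇒≢ : {u v : Fin n} → pair u v ≢ ⊥ → u ≢ v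
  pair≢⇒≢ ≢⊥ refl = ≢⊥ (△-self _)

  pair-unique : {u v x y : Fin n} → u ≢ v → pair u v ≡ pair x y →
                (u ≡ x × v ≡ y) ⊎ (u ≡ y × v ≡ x)
  pair-unique {u = u} {v} u≢v eq
    with pair-elim (trans (cong (λ S → lookup S u) (sym eq)) (∈-pairˡ u≢v))
       | pair-elim (trans (cong (λ S → lookup S v) (sym eq)) (∈-pairʳ u≢v))
  ... | inj₁ u≡x | inj₁ v≡x = ⊥-elim (u≢v (trans u≡x (sym v≡x)))
  ... | inj₁ u≡x | inj₂ v≡y = inj₁ (u≡x , v≡y)
  ... | inj₂ u≡y | inj₁ v≡x = inj₂ (u≡y , v≡x)
  ... | inj₂ u≡y | inj₂ v≡y = ⊥-elim (u≢v (trans u≡y (sym v≡y)))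

  -- The shared vertex cancels. Since `pair` is built from `△`, this also covers coinciding
  -- vertices, where a pair is empty.
  pair△pairˡ : (u v w : Fin n) → pair u v △ pair u w ≡ pair v w
  pair△pairˡ u v w = △-translate ⁅ u ⁆ ⁅ v ⁆ ⁅ w ⁆

  pair△pairʳ : (u v w : Fin n) → pair u w △ pair v w ≡ pair u v
  pair△pairʳ u v w = sym (△-path ⁅ u ⁆ ⁅ v ⁆ ⁅ w ⁆)

  pair-self : (u : Fin n) → pair u u ≡ ⊥
  pair-self u = △-self ⁅ u ⁆

  pair≡∪ : {u v : Fin n} → u ≢ v → pair u v ≡ ⁅ u ⁆ ∪ ⁅ v ⁆
  pair≡∪ {u = u} {v} u≢v = lookup-ext λ x → begin
    lookup (pair u v) x                  ≡⟨ lookup-△ ⁅ u ⁆ ⁅ v ⁆ x ⟩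
    lookup ⁅ u ⁆ x xor lookup ⁅ v ⁆ x    ≡⟨ disjoint x ⟩
    lookup ⁅ u ⁆ x ∨ lookup ⁅ v ⁆ x      ≡⟨ lookup-zipWith _∨_ x ⁅ u ⁆ ⁅ v ⁆ ⟨
    lookup (⁅ u ⁆ ∪ ⁅ v ⁆) x             ∎
    where
    open ≡-Reasoning
    disjoint : ∀ x → lookup ⁅ u ⁆ x xor lookup ⁅ v ⁆ x ≡ lookup ⁅ u ⁆ x ∨ lookup ⁅ v ⁆ x
    disjoint x with x ≟ u
    ... | yes refl rewrite ⁅⁆-same x | ⁅⁆-diff u≢v = refl
    ... | no x≢u   rewrite ⁅⁆-diff x≢u = refl

  △-pair : (A : Subset n) (u v : Fin n) → A △ pair u v ≡ (A △ ⁅ u ⁆) △ ⁅ v ⁆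
  △-pair A u v = sym (△-assoc A ⁅ u ⁆ ⁅ v ⁆)

-- Sizes

∣△⁅⁆∣-∉ : (A : Subset n) (x : Fin n) → lookup A x ≡ false → ∣ A △ ⁅ x ⁆ ∣ ≡ suc ∣ A ∣
∣△⁅⁆∣-∉ (false ∷ A) zero    _   = cong (suc ∘ ∣_∣) (△-identityʳ A)
∣△⁅⁆∣-∉ (true ∷ A)  (suc x) x∉A = cong suc (∣△⁅⁆∣-∉ A x x∉A)
∣△⁅⁆∣-∉ (false ∷ A) (suc x) x∉A = ∣△⁅⁆∣-∉ A x x∉A

∣△⁅⁆∣-∈ : (A : Subset n) (x : Fin n) → lookup A x ≡ true → suc ∣ A △ ⁅ x ⁆ ∣ ≡ ∣ A ∣
∣△⁅⁆∣-∈ (true ∷ A)  zero    _   = cong (suc ∘ ∣_∣) (△-identityʳ A)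
∣△⁅⁆∣-∈ (true ∷ A)  (suc x) x∈A = cong suc (∣△⁅⁆∣-∈ A x x∈A)
∣△⁅⁆∣-∈ (false ∷ A) (suc x) x∈A = ∣△⁅⁆∣-∈ A x x∈A

lookup-△⁅⁆ : (A : Subset n) {u v : Fin n} → v ≢ u → lookup (A △ ⁅ u ⁆) v ≡ lookup A v
lookup-△⁅⁆ A {u} {v} v≢u = trans (lookup-△ A ⁅ u ⁆ v)
  (trans (cong (lookup A v xor_) (⁅⁆-diff v≢u)) (Bool.xor-identityʳ _))

separated : (A : Subset n) {u v : Fin n} →
            lookup A u ≡ true → lookup A v ≡ false → u ≢ v
separated A u∈A v∉A refl = true≢false u∈A v∉A

∣△pair∣ : (A : Subset n) {u v : Fin n} →
          lookup A u ≡ true → lookup A v ≡ false → ∣ A △ pair u v ∣ ≡ ∣ A ∣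
∣△pair∣ A {u} {v} u∈A v∉A = begin
  ∣ A △ pair u v ∣          ≡⟨ cong ∣_∣ (△-pair A u v) ⟩
  ∣ (A △ ⁅ u ⁆) △ ⁅ v ⁆ ∣   ≡⟨ ∣△⁅⁆∣-∉ (A △ ⁅ u ⁆) v (trans (lookup-△⁅⁆ A (u≢v ∘ sym)) v∉A) ⟩
  suc ∣ A △ ⁅ u ⁆ ∣         ≡⟨ ∣△⁅⁆∣-∈ A u u∈A ⟩
  ∣ A ∣                     ∎
  where
  open ≡-Reasoning
  u≢v = separated A u∈A v∉A

∣∣≡1⇒unique : (A : Subset n) → ∣ A ∣ ≡ 1 → ∀ {x y} →
              lookup A x ≡ true → lookup A y ≡ true → x ≡ y
∣∣≡1⇒unique A ∣A∣≡1 {x} {y} x∈A y∈A with x ≟ y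
... | yes x≡y = x≡y
... | no x≢y = contradiction
  (trans (∣△⁅⁆∣-∈ (A △ ⁅ x ⁆) y (trans (lookup-△⁅⁆ A (x≢y ∘ sym)) y∈A))
         (ℕ.suc-injective (trans (∣△⁅⁆∣-∈ A x x∈A) ∣A∣≡1)))
  λ ()

-- Toggling two vertices on the same side of `A` changes its size by two, so an unchanged size puts
-- them on opposite sides.
△pair-split : (A : Subset n) {u v : Fin n} → u ≢ v → ∣ A △ pair u v ∣ ≡ ∣ A ∣ →
              (lookup A u ≡ true × lookup A v ≡ false) ⊎
              (lookup A v ≡ true × lookup A u ≡ false)
△pair-split A {u} {v} u≢v eq with lookup A u in Au | lookup A v in Av
... | true  | false = inj₁ (refl , refl)
... | false | true  = inj₂ (refl , refl)
... | true  | true  = ⊥-elim (ℕ.m≢1+n+m ∣ A △ pair u v ∣ {n = 1} (begin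
  ∣ A △ pair u v ∣                       ≡⟨ eq ⟩
  ∣ A ∣                                  ≡⟨ ∣△⁅⁆∣-∈ A u Au ⟨
  suc ∣ A △ ⁅ u ⁆ ∣                      ≡⟨ cong suc (∣△⁅⁆∣-∈ (A △ ⁅ u ⁆) v
                                              (trans (lookup-△⁅⁆ A (u≢v ∘ sym)) Av)) ⟨
  suc (suc ∣ (A △ ⁅ u ⁆) △ ⁅ v ⁆ ∣)      ≡⟨ cong (λ S → 2 ℕ.+ ∣ S ∣) (△-pair A u v) ⟨
  suc (suc ∣ A △ pair u v ∣)             ∎))
  where open ≡-Reasoning
... | false | false = ⊥-elim (ℕ.m≢1+n+m ∣ A ∣ {n = 1} (begin
  ∣ A ∣                                  ≡⟨ eq ⟨
  ∣ A △ pair u v ∣                       ≡⟨ cong ∣_∣ (△-pair A u v) ⟩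
  ∣ (A △ ⁅ u ⁆) △ ⁅ v ⁆ ∣                ≡⟨ ∣△⁅⁆∣-∉ (A △ ⁅ u ⁆) v
                                              (trans (lookup-△⁅⁆ A (u≢v ∘ sym)) Av) ⟩
  suc ∣ A △ ⁅ u ⁆ ∣                      ≡⟨ cong suc (∣△⁅⁆∣-∉ A u Au) ⟩
  suc (suc ∣ A ∣)                        ∎))
  where open ≡-Reasoning

enumerate : (A : Subset n) → k ℕ.≤ ∣ A ∣ →
            Σ (Fin k → Fin n) λ f → Injective _≡_ _≡_ f × (∀ i → lookup A (f i) ≡ true)
enumerate {k = zero}  A           _ = (λ ()) , (λ { {()} }) , λ ()
enumerate {k = suc k} (false ∷ A) k≤ with enumerate A k≤
... | f , f-inj , f∈A = suc ∘ f , f-inj ∘ suc-injective , f∈A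
enumerate {k = suc k} (true ∷ A) (s≤s k≤) with enumerate A k≤
... | f , f-inj , f∈A = g , g-inj , g∈A
  where
  g : Fin (suc k) → _
  g zero    = zero
  g (suc i) = suc (f i)
  g-inj : Injective _≡_ _≡_ g
  g-inj {zero}  {zero}  _  = refl
  g-inj {suc i} {suc j} eq = cong suc (f-inj (suc-injective eq))
  g∈A : ∀ i → lookup (true ∷ A) (g i) ≡ true
  g∈A zero    = refl
  g∈A (suc i) = f∈A i

-- The reflexive closure of the Johnson graph

-- A witness with `u ≡ v` gives equality. Sizes are left to the context: between distinct sets of
-- equal size this is adjacency in the Johnson graph.
Close : Subset n → Subset n → Set
Close A B = ∃₂ λ u v → A △ B ≡ pair u v

close? : (A B : Subset n) → Dec (Close A B)
close? A B = any? λ u → any? λ v → ≡-dec Bool._≟_ (A △ B) (pair u v)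

close-sym : {A B : Subset n} → Close A B → Close B A
close-sym {A = A} {B} (u , v , eq) = u , v , trans (△-comm B A) eq

-- Distinctness rules out the empty pair and equal size rules out two vertices on one side. The
-- witness is oriented so that `u` leaves `A` and `v` enters.
exchange : {A B : Subset n} → ∣ A ∣ ≡ ∣ B ∣ → A ≢ B → Close A B →
           ∃₂ λ u v → lookup A u ≡ true × lookup A v ≡ false × A △ B ≡ pair u v
exchange {A = A} {B} ∣A∣≡∣B∣ A≢B (u , v , eq) with △pair-split A u≢v ∣△∣
  where
  B≡ = △-solve eq
  ∣△∣ = trans (cong ∣_∣ (sym B≡)) (sym ∣A∣≡∣B∣)
  u≢v = pair≢⇒≢ λ uv≡⊥ → A≢B (sym (trans B≡ (trans (cong (A △_) uv≡⊥) (△-identityʳ A))))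
... | inj₁ (u∈A , v∉A) = u , v , u∈A , v∉A , eq
... | inj₂ (v∈A , u∉A) = v , u , v∈A , u∉A , trans eq (pair-comm u v)

no-three : {x y a b c : Fin n} → a ≢ b → a ≢ c → b ≢ c →
           lookup (pair x y) a ≡ true → lookup (pair x y) b ≡ true →
           lookup (pair x y) c ≢ true
no-three a≢b a≢c b≢c a∈ b∈ c∈ with pair-elim a∈ | pair-elim b∈ | pair-elim c∈
... | inj₁ refl | inj₁ refl | _         = a≢b refl
... | inj₁ refl | inj₂ refl | inj₁ refl = a≢c refl
... | inj₁ refl | inj₂ refl | inj₂ refl = b≢c refl
... | inj₂ refl | inj₁ refl | inj₁ refl = b≢c refl
... | inj₂ refl | inj₁ refl | inj₂ refl = a≢c refl
... | inj₂ refl | inj₂ refl | _         = a≢b refl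

∈-pair△pairˡ : {u v w z x : Fin n} → lookup (pair u v) x ≡ true → x ≢ w → x ≢ z →
               lookup (pair u v △ pair w z) x ≡ true
∈-pair△pairˡ {u = u} {v} {w} {z} {x} x∈ x≢w x≢z =
  trans (lookup-△ (pair u v) (pair w z) x) (cong₂ _xor_ x∈ (∉-pair x≢w x≢z))

∈-pair△pairʳ : {u v w z x : Fin n} → lookup (pair w z) x ≡ true → x ≢ u → x ≢ v →
               lookup (pair u v △ pair w z) x ≡ true
∈-pair△pairʳ {u = u} {v} {w} {z} {x} x∈ x≢u x≢v =
  trans (lookup-△ (pair u v) (pair w z) x) (cong₂ _xor_ (∉-pair x≢u x≢v) x∈)

module _ (A : Subset n) {r r′ s s′ : Fin n}
         (r∈A : lookup A r ≡ true) (r′∈A : lookup A r′ ≡ true)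
         (s∉A : lookup A s ≡ false) (s′∉A : lookup A s′ ≡ false) where

  -- If both coordinates differed, then `r`, `s` and `r′` would be three distinct elements of a
  -- difference that is a single pair.
  close⇒shared : Close (A △ pair r s) (A △ pair r′ s′) → r ≡ r′ ⊎ s ≡ s′
  close⇒shared (x , y , eq) with r ≟ r′ | s ≟ s′
  ... | yes r≡r′ | _        = inj₁ r≡r′
  ... | no _     | yes s≡s′ = inj₂ s≡s′
  ... | no r≢r′  | no s≢s′  = ⊥-elim (no-three r≢s r≢r′ (r′≢s ∘ sym)
    (∈xy (∈-pair△pairˡ (∈-pairˡ r≢s) r≢r′ r≢s′))
    (∈xy (∈-pair△pairˡ (∈-pairʳ r≢s) (r′≢s ∘ sym) s≢s′))
    (∈xy (∈-pair△pairʳ (∈-pairˡ r′≢s′) (r≢r′ ∘ sym) r′≢s)))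
    where
    r≢s   = separated A r∈A s∉A
    r≢s′  = separated A r∈A s′∉A
    r′≢s  = separated A r′∈A s∉A
    r′≢s′ = separated A r′∈A s′∉A
    ∈xy : ∀ {z} → lookup (pair r s △ pair r′ s′) z ≡ true → lookup (pair x y) z ≡ true
    ∈xy {z} = trans (cong (λ S → lookup S z) (trans (sym eq) (△-translate A _ _)))

shared⇒close : (A : Subset n) {r r′ s s′ : Fin n} → r ≡ r′ ⊎ s ≡ s′ →
               Close (A △ pair r s) (A △ pair r′ s′)
shared⇒close A {r} {s = s} {s′} (inj₁ refl) =
  s , s′ , trans (△-translate A _ _) (pair△pairˡ r s s′)
shared⇒close A {r} {r′} {s} (inj₂ refl) =
  r , r′ , trans (△-translate A _ _) (pair△pairʳ r r′ s)

-- `A` and `C` are distinct because `B` is close to `C` but not to `A`, so `exchange` applies.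
apart-exchange : {A B C : Subset n} → ¬ Close A B → ∣ A ∣ ≡ ∣ C ∣ → Close A C → Close B C →
                 ∃₂ λ u v → lookup A u ≡ true × lookup A v ≡ false × A △ C ≡ pair u v
apart-exchange {B = B} A≁B ∣A∣≡∣C∣ A∼C B∼C =
  exchange ∣A∣≡∣C∣ (λ A≡C → A≁B (close-sym (subst (Close B) (sym A≡C) B∼C))) A∼C

-- The common neighbours of two k-sets at distance 2 in the Johnson graph
-- arise from a choice of one out of two elements to remove and one out of
-- two elements to add.
module _ {A B : Subset n} (A≁B : ¬ Close A B) where

  -- A vertex common to both pairs would cancel in `(A △ C) △ (B △ C)`, leaving `A △ B` a single
  -- pair.
  apart-disjoint : ∀ {C u v w z} → A △ C ≡ pair u v → B △ C ≡ pair w z →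
                   u ≢ w × u ≢ z × v ≢ w × v ≢ z
  apart-disjoint {C} {u} {v} {w} {z} AC BC =
    (λ { refl → A≁B (v , z , trans A△B (pair△pairˡ u v z)) }) ,
    (λ { refl → A≁B (v , w , trans A△B
           (trans (cong (pair u v △_) (pair-comm w u)) (pair△pairˡ u v w))) }) ,
    (λ { refl → A≁B (u , z , trans A△B
           (trans (cong (pair u v △_) (pair-comm v z)) (pair△pairʳ u z v))) }) ,
    (λ { refl → A≁B (u , w , trans A△B (pair△pairʳ u w v)) })
    where
    A△B = trans (△-path A B C) (cong₂ _△_ AC BC)

  -- The set `A △ B` consists of `u`, `v`, `w`, `z`, with `u` and `z` in `A` and `v` and `w` outside
  -- it. By `apart-disjoint`, the move from `A` to `C′` toggles only vertices of `A △ B`, so it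
  -- removes one of the former and adds one of the latter.
  common-moves : ∀ {C C′ u v w z u′ v′ w′ z′} →
    lookup A u ≡ true → lookup A v ≡ false → A △ C ≡ pair u v →
    lookup B w ≡ true → lookup B z ≡ false → B △ C ≡ pair w z →
    lookup A u′ ≡ true → lookup A v′ ≡ false → A △ C′ ≡ pair u′ v′ →
    B △ C′ ≡ pair w′ z′ →
    (u′ ≡ u ⊎ u′ ≡ z) × (v′ ≡ v ⊎ v′ ≡ w)
  common-moves {C} {C′} {u} {v} {w} {z} {u′} {v′}
    u∈A v∉A AC w∈B z∉B BC u′∈A v′∉A AC′ BC′ = removed , added
    where
    △-via : ∀ {C P Q} → A △ C ≡ P → B △ C ≡ Q → A △ B ≡ P △ Q
    △-via AC BC = trans (△-path A B _) (cong₂ _△_ AC BC)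

    ∈AB⇒ : ∀ {x} → lookup (A △ B) x ≡ true → (x ≡ u ⊎ x ≡ v) ⊎ (x ≡ w ⊎ x ≡ z)
    ∈AB⇒ {x} x∈ with lookup (pair u v) x in x∈uv
    ... | true  = inj₁ (pair-elim x∈uv)
    ... | false = inj₂ (pair-elim (trans (sym (cong (_xor _) x∈uv)) (trans (sym
                    (lookup-△ (pair u v) (pair w z) x))
                    (trans (cong (λ S → lookup S x) (sym (△-via AC BC))) x∈))))

    ∈AB : ∀ {C u v w z x} → A △ C ≡ pair u v → B △ C ≡ pair w z →
          lookup (pair u v) x ≡ true → x ≢ w → x ≢ z → lookup (A △ B) x ≡ true
    ∈AB AC BC x∈ x≢w x≢z =
      trans (cong (λ S → lookup S _) (△-via AC BC)) (∈-pair△pairˡ x∈ x≢w x≢z)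

    -- `w` and `z` lie in the second pair only, hence in `A △ B`, so membership in `A` is opposite
    -- to membership in `B`.
    w∉A : lookup A w ≡ false
    w∉A = not-∈ (trans (sym (lookup-△ A B w)) (trans (cong (λ S → lookup S w) (△-via AC BC))
            (∈-pair△pairʳ (∈-pairˡ (separated B w∈B z∉B)) (dis .proj₁ ∘ sym)
              (dis .proj₂ .proj₂ .proj₁ ∘ sym))))
      where
      dis = apart-disjoint AC BC
      not-∈ : ∀ {a} → a xor lookup B w ≡ true → a ≡ false
      not-∈ {false} _  = refl
      not-∈ {true}  eq = ⊥-elim (true≢false eq (cong not w∈B))

    z∈A : lookup A z ≡ true
    z∈A = is-∈ (trans (sym (lookup-△ A B z)) (trans (cong (λ S → lookup S z) (△-via AC BC))
            (∈-pair△pairʳ (∈-pairʳ (separated B w∈B z∉B)) (dis .proj₂ .proj₁ ∘ sym)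
              (dis .proj₂ .proj₂ .proj₂ ∘ sym))))
      where
      dis = apart-disjoint AC BC
      is-∈ : ∀ {a} → a xor lookup B z ≡ true → a ≡ true
      is-∈ {true}  _  = refl
      is-∈ {false} eq = ⊥-elim (true≢false eq z∉B)

    u′≢v′ = separated A u′∈A v′∉A
    dis′  = apart-disjoint AC′ BC′

    removed : u′ ≡ u ⊎ u′ ≡ z
    removed with ∈AB⇒ (∈AB AC′ BC′ (∈-pairˡ u′≢v′) (dis′ .proj₁) (dis′ .proj₂ .proj₁))
    ... | inj₁ (inj₁ u′≡u) = inj₁ u′≡u
    ... | inj₁ (inj₂ u′≡v) = ⊥-elim (separated A u′∈A v∉A u′≡v)
    ... | inj₂ (inj₁ u′≡w) = ⊥-elim (separated A u′∈A w∉A u′≡w)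
    ... | inj₂ (inj₂ u′≡z) = inj₂ u′≡z

    added : v′ ≡ v ⊎ v′ ≡ w
    added with ∈AB⇒ (∈AB AC′ BC′ (∈-pairʳ u′≢v′) (dis′ .proj₂ .proj₂ .proj₁)
                                                  (dis′ .proj₂ .proj₂ .proj₂))
    ... | inj₁ (inj₁ v′≡u) = ⊥-elim (separated A u∈A v′∉A (sym v′≡u))
    ... | inj₁ (inj₂ v′≡v) = inj₁ v′≡v
    ... | inj₂ (inj₁ v′≡w) = inj₂ v′≡w
    ... | inj₂ (inj₂ v′≡z) = ⊥-elim (separated A z∈A v′∉A (sym v′≡z))

  -- The common neighbour `C 0F` fixes the four options of `common-moves`; each `C i` is one of
  -- them, so two of the five coincide.
  ≤4-common : ∣ A ∣ ≡ ∣ B ∣ → (C : Fin 5 → Subset n) → (∀ i → ∣ C i ∣ ≡ ∣ A ∣) →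
              (∀ i → Close A (C i)) → (∀ i → Close B (C i)) →
              ∃₂ λ i j → i ≢ j × C i ≡ C j
  ≤4-common ∣A∣≡∣B∣ C ∣C∣ A∼C B∼C
    with apart-exchange A≁B (sym (∣C∣ 0F)) (A∼C 0F) (B∼C 0F)
       | apart-exchange (A≁B ∘ close-sym) (trans (sym ∣A∣≡∣B∣) (sym (∣C∣ 0F))) (B∼C 0F) (A∼C 0F)
  ... | u , v , u∈A , v∉A , AC | w , z , w∈B , z∉B , BC =
    let i , j , i<j , same = pigeonhole ℕ.≤-refl (proj₁ ∘ choice)
    in i , j , (λ i≡j → ℕ.<-irrefl (cong toℕ i≡j) i<j) ,
       △-injective (trans (proj₂ (choice i)) (trans (cong option same) (sym (proj₂ (choice j)))))
    where
    option : Fin 4 → Subset n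
    option 0F = pair u v
    option 1F = pair u w
    option 2F = pair z v
    option 3F = pair z w

    choice : ∀ i → ∃ λ c → A △ C i ≡ option c
    choice i with apart-exchange A≁B (sym (∣C∣ i)) (A∼C i) (B∼C i)
    ... | u′ , v′ , u′∈A , v′∉A , AC′
      with common-moves u∈A v∉A AC w∈B z∉B BC u′∈A v′∉A AC′ (B∼C i .proj₂ .proj₂)
    ... | inj₁ refl , inj₁ refl = 0F , AC′
    ... | inj₁ refl , inj₂ refl = 1F , AC′
    ... | inj₂ refl , inj₁ refl = 2F , AC′
    ... | inj₂ refl , inj₂ refl = 3F , AC′

-- Injective maps of finite sets

module _ {X : Set} {N : ℕ} (X↔Fin : X ↔ Fin N)
         (g : X → X) (g-injective : Injective _≡_ _≡_ g) where

  private
    iterate : ℕ → X → X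
    iterate zero    x = x
    iterate (suc i) x = g (iterate i x)

    -- Injectivity strips one `g` from both sides until the shorter iterate is `x` itself.
    periodic : ∀ {i j x} → i ℕ.< j → iterate i x ≡ iterate j x → ∃ λ d → x ≡ iterate (suc d) x
    periodic {zero}  {suc j} _         eq = j , eq
    periodic {suc i} {suc j} (s≤s i<j) eq = periodic i<j (g-injective eq)

  -- Every orbit of an injective endomap of a finite set is a cycle.
  orbit-closed : {P : X → Set} → (∀ {x} → P x → P (g x)) → ∀ {x} → P (g x) → P x
  orbit-closed {P} closed {x} Pgx
    with pigeonhole (ℕ.n<1+n N) (λ i → Inverse.to X↔Fin (iterate (toℕ i) x))
  ... | i , j , i<j , eq
    with periodic i<j (Injection.injective (↔⇒↣ X↔Fin) eq)
  ... | d , x≡ = subst P (sym x≡) (along d)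
    where
    along : ∀ d → P (iterate (suc d) x)
    along zero    = Pgx
    along (suc d) = closed (along d)

injective⇒↔ : (f : Fin n → Fin n) → Injective _≡_ _≡_ f → Fin n ↔ Fin n
injective⇒↔ f f-inj =
  mk↔ₛ′ f (proj₁ ∘ preimage) (proj₂ ∘ preimage) (λ x → f-inj (proj₂ (preimage (f x))))
  where
  preimage : ∀ y → ∃ λ x → f x ≡ y
  -- Being in the image is closed under `f` and holds of `f y`, so it can be pulled back to `y`.
  preimage y = orbit-closed ↔-refl f f-inj {P = λ y → ∃ λ x → f x ≡ y}
    (λ {y} _ → y , refl) (y , refl)

-- Line-preserving maps of a grid

-- The case where rows go to rows and columns to columns; the transposed case is `Straight s r`.
Straight : {P Q R S : Set} → (P → Q → R) → (P → Q → S) → Set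
Straight r s = (∀ a b b′ → r a b ≡ r a b′) × (∀ a a′ b → s a b ≡ s a′ b)

module _ {P Q R S : Set} (_≟P_ : DecidableEquality P) (_≟Q_ : DecidableEquality Q)
         (r : P → Q → R) (s : P → Q → S)
         (lines : ∀ {a a′ b b′} → a ≡ a′ ⊎ b ≡ b′ → r a b ≡ r a′ b′ ⊎ s a b ≡ s a′ b′)
         (unlines : ∀ {a a′ b b′} → r a b ≡ r a′ b′ ⊎ s a b ≡ s a′ b′ → a ≡ a′ ⊎ b ≡ b′)
         where

  private
    -- The images of the cells `(a , b)` and `(a′ , b)` share a line. Were it a row, it would also
    -- hold the image of `(a , b′)`, which lies on no line with `(a′ , b)`.
    row⇒column : ∀ {a a′ b b′} → a ≢ a′ → b ≢ b′ → r a b ≡ r a b′ → s a b ≡ s a′ b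
    row⇒column {a} {a′} {b} {b′} a≢a′ b≢b′ row with lines {a} {a′} {b} {b} (inj₂ refl)
    ... | inj₂ column = column
    ... | inj₁ eq with unlines {a} {a′} {b′} {b} (inj₁ (trans (sym row) eq))
    ...   | inj₁ a≡a′ = ⊥-elim (a≢a′ a≡a′)
    ...   | inj₂ b′≡b = ⊥-elim (b≢b′ (sym b′≡b))

    column⇒row : ∀ {a a′ b b′} → a ≢ a′ → b ≢ b′ → s a b ≡ s a′ b → r a b ≡ r a b′
    column⇒row {a} {a′} {b} {b′} a≢a′ b≢b′ column with lines {a} {a} {b} {b′} (inj₁ refl)
    ... | inj₁ row = row
    ... | inj₂ eq with unlines {a′} {a} {b} {b′} (inj₂ (trans (sym column) eq))
    ...   | inj₁ a′≡a = ⊥-elim (a≢a′ (sym a′≡a))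
    ...   | inj₂ b≡b′ = ⊥-elim (b≢b′ b≡b′)

  -- Straightness of one row spreads by alternation: from two cells of row `a₀` to column `b₀`, from
  -- there to all of row `a₀`, then to every column, and finally to every row.
  straight : ∀ {a₀ a₁ b₀ b₁} → a₀ ≢ a₁ → b₀ ≢ b₁ → r a₀ b₀ ≡ r a₀ b₁ → Straight r s
  straight {a₀} {a₁} {b₀} {b₁} a₀≢a₁ b₀≢b₁ row =
    rows , λ a a′ b → trans (sym (columns a b)) (columns a′ b)
    where
    columns₀ : ∀ a → s a₀ b₀ ≡ s a b₀
    columns₀ a with a₀ ≟P a
    ... | yes refl = refl
    ... | no a₀≢a  = row⇒column a₀≢a b₀≢b₁ row

    rows₀ : ∀ b → r a₀ b₀ ≡ r a₀ b
    rows₀ b with b₀ ≟Q b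
    ... | yes refl = refl
    ... | no b₀≢b  = column⇒row a₀≢a₁ b₀≢b (columns₀ a₁)

    columns : ∀ a b → s a₀ b ≡ s a b
    columns a b with a₀ ≟P a | b ≟Q b₀
    ... | yes refl | _        = refl
    ... | no a₀≢a  | yes refl = columns₀ a
    ... | no a₀≢a  | no b≢b₀  = row⇒column a₀≢a b≢b₀ (sym (rows₀ b))

    rows : ∀ a b b′ → r a b ≡ r a b′
    rows a b b′ with b ≟Q b′ | a ≟P a₀
    ... | yes refl | _        = refl
    ... | no b≢b′  | yes refl = trans (sym (rows₀ b)) (rows₀ b′)
    ... | no b≢b′  | no a≢a₀  = column⇒row a≢a₀ b≢b′ (sym (columns a b))

-- Edges of token graphs

edge⇒pair : (G : Graph (Fin n)) {S : Subset n} → IsEdge G S →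
            ∃₂ λ u v → u ≢ v × Adj G u v × S ≡ pair u v
edge⇒pair G (u , v , uv , S≡) = u , v , u≢v , uv , trans S≡ (sym (pair≡∪ u≢v))
  where
  u≢v : u ≢ v
  u≢v u≡v = irrefl G u≡v uv

adj⇒edge : (G : Graph (Fin n)) {S : Subset n} {u v : Fin n} →
           Adj G u v → S ≡ pair u v → IsEdge G S
adj⇒edge G {u = u} {v} uv S≡ = u , v , uv , trans S≡ (pair≡∪ λ u≡v → irrefl G u≡v uv)

edge⇒adj : (G : Graph (Fin n)) {S : Subset n} {u v : Fin n} →
           u ≢ v → S ≡ pair u v → IsEdge G S → Adj G u v
edge⇒adj G u≢v S≡ e with edge⇒pair G e
... | x , y , _ , xy , S≡xy with pair-unique u≢v (trans (sym S≡) S≡xy)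
...   | inj₁ (refl , refl) = xy
...   | inj₂ (refl , refl) = symm G xy

edge⇒close : (G : Graph (Fin n)) {A B : Subset n} → IsEdge G (A △ B) → Close A B
edge⇒close G e = let u , v , _ , _ , eq = edge⇒pair G e in u , v , eq

-- Five is one more than the number of common neighbours allowed by `≤4-common`.
Rich : Graph (Fin n) → Set
Rich {n} G = ∀ {u v} → u ≢ v →
  Σ (Fin 5 → Fin n) λ f → Injective _≡_ _≡_ f × (∀ i → Adj G u (f i) × Adj G v (f i))

module _ (G : Graph (Fin n)) {A B : Subset n} {u v : Fin n}
         (u∈A : lookup A u ≡ true) (v∉A : lookup A v ≡ false) (AB : A △ B ≡ pair u v) where

  -- A common neighbour of `A` and `B` in the token graph that remembers `x`: by `through` and
  -- `only`, `x` can be read off from `via` up to confusion with `u` and `v`.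
  record Detour (x : Fin n) : Set where
    field
      via     : Subset n
      size    : ∣ via ∣ ≡ ∣ A ∣
      edgeˡ   : IsEdge G (A △ via)
      edgeʳ   : IsEdge G (B △ via)
      through : lookup (A △ via) x ≡ true
      only    : ∀ {y} → lookup (A △ via) y ≡ true → y ≡ x ⊎ (y ≡ u ⊎ y ≡ v)

  -- To move a token from `u` to `v` through `x`: if `x` is occupied, its token goes to `v` and the
  -- one at `u` replaces it; otherwise the token at `u` goes to `x` and then on to `v`.
  detour : ∀ {x} → Adj G u x → Adj G v x → Detour x
  detour {x} ux vx with lookup A x in eq
  ... | true = record
    { via     = A △ pair x v
    ; size    = ∣△pair∣ A eq v∉A
    ; edgeˡ   = adj⇒edge G (symm G vx) A△via
    ; edgeʳ   = adj⇒edge G ux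
        (trans (cong (_△ _) (△-solve AB)) (trans (△-translate A _ _) (pair△pairʳ u x v)))
    ; through = trans (cong (λ S → lookup S x) A△via) (∈-pairˡ (separated A eq v∉A))
    ; only    = λ {y} y∈ → case pair-elim {u = x} {v}
                  (trans (cong (λ S → lookup S y) (sym A△via)) y∈) of λ where
        (inj₁ y≡x) → inj₁ y≡x
        (inj₂ y≡v) → inj₂ (inj₂ y≡v)
    }
    where A△via = △-involutive A (pair x v)
  ... | false = record
    { via     = A △ pair u x
    ; size    = ∣△pair∣ A u∈A eq
    ; edgeˡ   = adj⇒edge G ux A△via
    ; edgeʳ   = adj⇒edge G vx
        (trans (cong (_△ _) (△-solve AB)) (trans (△-translate A _ _) (pair△pairˡ u v x)))
    ; through = trans (cong (λ S → lookup S x) A△via) (∈-pairʳ (separated A u∈A eq))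
    ; only    = λ {y} y∈ → case pair-elim {u = u} {x}
                  (trans (cong (λ S → lookup S y) (sym A△via)) y∈) of λ where
        (inj₁ y≡u) → inj₂ (inj₁ y≡u)
        (inj₂ y≡x) → inj₁ y≡x
    }
    where A△via = △-involutive A (pair u x)

  five-detours : Rich G →
    Σ (Fin 5 → Subset n) λ C → Injective _≡_ _≡_ C × (∀ i → ∣ C i ∣ ≡ ∣ A ∣) ×
      (∀ i → IsEdge G (A △ C i)) × (∀ i → IsEdge G (B △ C i))
  five-detours rich with rich (separated A u∈A v∉A)
  ... | f , f-inj , adj =
    via ∘ d , C-injective , size ∘ d , edgeˡ ∘ d , edgeʳ ∘ d
    where
    open Detour
    d : ∀ i → Detour (f i)
    d i = detour (proj₁ (adj i)) (proj₂ (adj i))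
    C-injective : Injective _≡_ _≡_ (via ∘ d)
    -- Equal detours make `f i` one of `f j`, `u`, `v`, and the last two would give a loop in `G`.
    C-injective {i} {j} eq
      with only (d j) (trans (cong (λ C → lookup (A △ C) (f i)) (sym eq)) (through (d i)))
    ... | inj₁ fi≡fj        = f-inj fi≡fj
    ... | inj₂ (inj₁ fi≡u)  = ⊥-elim (irrefl G (sym fi≡u) (proj₁ (adj i)))
    ... | inj₂ (inj₂ fi≡v)  = ⊥-elim (irrefl G (sym fi≡v) (proj₂ (adj i)))

-- Reconstruction

module _ {G H : Graph (Fin n)} (rich : Rich G) (1≤k : 1 ℕ.≤ k) (k<n : k ℕ.< n)
         (iso : tokenGraph k G ≅ tokenGraph k H) where

  private
    φ : KSubset n k → KSubset n k
    φ = Inverse.to (bij iso)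

    φ-injective : Injective _≡_ _≡_ φ
    φ-injective = Injection.injective (↔⇒↣ (bij iso))

    -- The five detours between `A` and `B` go to five distinct common neighbours of their images,
    -- too many for sets that are not close.
    φ-apart : {A B : KSubset n k} → proj₁ A ≢ proj₁ B → Close (proj₁ A) (proj₁ B) →
              ¬ ¬ Close (proj₁ (φ A)) (proj₁ (φ B))
    φ-apart {A} {B} A≢B A∼B φA≁φB =
      let u , v , u∈A , v∉A , AB = exchange (trans (proj₂ A) (sym (proj₂ B))) A≢B A∼B
          C , C-inj , ∣C∣ , AC , BC = five-detours G u∈A v∉A AB rich
          C′ : Fin 5 → KSubset n k
          C′ i = C i , trans (∣C∣ i) (proj₂ A)
          i , j , i≢j , eq = ≤4-common φA≁φB (trans (proj₂ (φ A)) (sym (proj₂ (φ B))))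
            (λ i → proj₁ (φ (C′ i)))
            (λ i → trans (proj₂ (φ (C′ i))) (sym (proj₂ (φ A))))
            (λ i → edge⇒close H (Equivalence.to (preserve iso A (C′ i)) (AC i)))
            (λ i → edge⇒close H (Equivalence.to (preserve iso B (C′ i)) (BC i)))
      in i≢j (C-inj (cong proj₁ (φ-injective {C′ i} {C′ j} (KSubset-≡ eq))))

    φ-close : {A B : KSubset n k} → Close (proj₁ A) (proj₁ B) → Close (proj₁ (φ A)) (proj₁ (φ B))
    φ-close {A} {B} A∼B@(u , _) = decide (≡-dec Bool._≟_ (proj₁ A) (proj₁ B))
      where
      decide : Dec (proj₁ A ≡ proj₁ B) → Close (proj₁ (φ A)) (proj₁ (φ B))
      -- The vertex `u` of the given witness only serves to name an empty pair.
      decide (yes A≡B) = u , u , trans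
        (cong (λ C → proj₁ (φ A) △ proj₁ (φ C)) (sym (KSubset-≡ {A = A} {B} A≡B)))
        (trans (△-self (proj₁ (φ A))) (sym (pair-self u)))
      decide (no A≢B) = decidable-stable (close? (proj₁ (φ A)) (proj₁ (φ B)))
        (φ-apart {A} {B} A≢B A∼B)

    -- `φ × φ` is an injective endomap of the finite set of pairs of k-sets under which closeness is
    -- closed, so `orbit-closed` reverses the implication.
    φ-close⁻¹ : {A B : KSubset n k} → Close (proj₁ (φ A)) (proj₁ (φ B)) → Close (proj₁ A) (proj₁ B)
    φ-close⁻¹ {A} {B} = orbit-closed
      (↔-trans (KSubset↔Fin n k ×-↔ KSubset↔Fin n k) (↔-sym *↔×))
      (λ (A , B) → φ A , φ B)
      (λ eq → cong₂ _,_ (φ-injective (cong proj₁ eq)) (φ-injective (cong proj₂ eq)))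
      {P = λ (A , B) → Close (proj₁ A) (proj₁ B)}
      φ-close {A , B}

    A₀ : KSubset n k
    A₀ = Inverse.from (KSubset↔Fin n k) (fromℕ< (binom>0 n k (ℕ.<⇒≤ k<n)))

    A A′ : Subset n
    A  = proj₁ A₀
    A′ = proj₁ (φ A₀)

    In Out : Set
    In  = Σ (Fin n) λ x → lookup A x ≡ true
    Out = Σ (Fin n) λ x → lookup A x ≡ false

    el-≡ : ∀ {c} {x y : Σ (Fin n) λ x → lookup A x ≡ c} → proj₁ x ≡ proj₁ y → x ≡ y
    el-≡ {x = x , p} {.x , q} refl = cong (x ,_) (Decidable⇒UIP.≡-irrelevant Bool._≟_ p q)

    el-≟ : ∀ {c} → DecidableEquality (Σ (Fin n) λ x → lookup A x ≡ c)
    el-≟ x y = map′ el-≡ (cong proj₁) (proj₁ x ≟ proj₁ y)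

    move : In → Out → KSubset n k
    move (a , a∈) (b , b∉) = A △ pair a b , trans (∣△pair∣ A a∈ b∉) (proj₂ A₀)

    move-close : ∀ a b → Close A (proj₁ (move a b))
    move-close a b = proj₁ a , proj₁ b , △-involutive A _

    move≢ : ∀ a b → move a b ≢ A₀
    move≢ (a , a∈) (b , b∉) eq = true≢false (∈-pairˡ (separated A a∈ b∉)) (begin
      lookup (pair a b) a           ≡⟨ cong (λ S → lookup S a) (△-involutive A (pair a b)) ⟨
      lookup (A △ (A △ pair a b)) a ≡⟨ cong (λ S → lookup (A △ S) a) (cong proj₁ eq) ⟩
      lookup (A △ A) a              ≡⟨ cong (λ S → lookup S a) (△-self A) ⟩
      lookup ⊥ a                    ≡⟨ lookup-replicate a false ⟩
      false                         ∎)
      where open ≡-Reasoning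

    -- Neighbours of `A₀` go to neighbours of `φ A₀`; the witnesses `r` and `s` are the row and the
    -- column of the image in the grid around `φ A₀`.
    image : ∀ a b → ∃₂ λ r s → lookup A′ r ≡ true × lookup A′ s ≡ false ×
                               A′ △ proj₁ (φ (move a b)) ≡ pair r s
    image a b = exchange (trans (proj₂ (φ A₀)) (sym (proj₂ (φ (move a b)))))
      (λ eq → move≢ a b (φ-injective (KSubset-≡ (sym eq))))
      (φ-close {A₀} {move a b} (move-close a b))

    r s : In → Out → Fin n
    r a b = proj₁ (image a b)
    s a b = proj₁ (proj₂ (image a b))

    r∈A′ : ∀ a b → lookup A′ (r a b) ≡ true
    r∈A′ a b = proj₁ (proj₂ (proj₂ (image a b)))

    s∉A′ : ∀ a b → lookup A′ (s a b) ≡ false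
    s∉A′ a b = proj₁ (proj₂ (proj₂ (proj₂ (image a b))))

    image-△ : ∀ a b → A′ △ proj₁ (φ (move a b)) ≡ pair (r a b) (s a b)
    image-△ a b = proj₂ (proj₂ (proj₂ (proj₂ (image a b))))

    -- For two neighbours of a common set, sharing a line of the grid is the same as being close,
    -- and `φ` preserves closeness in both directions.
    lines : ∀ {a a′ b b′} → a ≡ a′ ⊎ b ≡ b′ → r a b ≡ r a′ b′ ⊎ s a b ≡ s a′ b′
    lines {a} {a′} {b} {b′} sh =
      close⇒shared A′ (r∈A′ a b) (r∈A′ a′ b′) (s∉A′ a b) (s∉A′ a′ b′)
        (subst₂ Close (△-solve (image-△ a b)) (△-solve (image-△ a′ b′))
          (φ-close {move a b} {move a′ b′} (shared⇒close A (Sum.map (cong proj₁) (cong proj₁) sh))))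

    unlines : ∀ {a a′ b b′} → r a b ≡ r a′ b′ ⊎ s a b ≡ s a′ b′ → a ≡ a′ ⊎ b ≡ b′
    unlines {a} {a′} {b} {b′} sh = Sum.map el-≡ el-≡
      (close⇒shared A (proj₂ a) (proj₂ a′) (proj₂ b) (proj₂ b′)
        (φ-close⁻¹ {move a b} {move a′ b′}
          (subst₂ Close (sym (△-solve (image-△ a b))) (sym (△-solve (image-△ a′ b′)))
            (shared⇒close A′ sh))))

  module _ (a₀ : In) (b₀ : Out) (f : In → Fin n) (g : Out → Fin n)
           (φ-move : ∀ a b → A′ △ proj₁ (φ (move a b)) ≡ pair (f a) (g b)) where

    private
      side : ∀ x → lookup A x ≡ true ⊎ lookup A x ≡ false
      side x with lookup A x
      ... | true  = inj₁ refl
      ... | false = inj₂ refl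

      -- Glues `f` on `A` to `g` off `A`. The values of `f` lie in `A′` in the straight case and
      -- outside it in the crossed case, so both cases are served at once.
      π : Fin n → Fin n
      π x = [ (λ x∈ → f (x , x∈)) , (λ x∉ → g (x , x∉)) ]′ (side x)

      move-injective : ∀ {a a′ b b′} → move a b ≡ move a′ b′ →
                       pair (proj₁ a) (proj₁ b) ≡ pair (proj₁ a′) (proj₁ b′)
      move-injective eq = △-injective (cong proj₁ eq)

      φ-move-injective : ∀ {a a′ b b′} → pair (f a) (g b) ≡ pair (f a′) (g b′) →
                         move a b ≡ move a′ b′
      φ-move-injective {a} {a′} {b} {b′} eq = φ-injective (KSubset-≡
        (△-injective (trans (φ-move a b) (trans eq (sym (φ-move a′ b′))))))

      -- With `b₀` fixed, equal values of `f` give equal images, hence equal moves and equal pairs;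
      -- the swapped matching would put `b₀` in `A`.
      f-injective : Injective _≡_ _≡_ f
      f-injective {a} {a′} eq =
        [ el-≡ ∘ proj₁ , ⊥-elim ∘ separated A (proj₂ a) (proj₂ b₀) ∘ proj₁ ]′
          (pair-unique (separated A (proj₂ a) (proj₂ b₀))
            (move-injective {a} {a′} {b₀} {b₀}
              (φ-move-injective (cong (λ x → pair x (g b₀)) eq))))

      g-injective : Injective _≡_ _≡_ g
      g-injective {b} {b′} eq =
        [ el-≡ ∘ proj₂ , ⊥-elim ∘ separated A (proj₂ a₀) (proj₂ b) ∘ sym ∘ proj₂ ]′
          (pair-unique (separated A (proj₂ a₀) (proj₂ b))
            (move-injective {a₀} {a₀} {b} {b′}
              (φ-move-injective (cong (λ x → pair (f a₀) x) eq))))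

      -- A common value would make the image pair empty, so that `φ` would identify a move with
      -- `A₀`.
      f≢g : ∀ a b → f a ≢ g b
      f≢g a b eq = move≢ a b (φ-injective (KSubset-≡ (begin
        proj₁ (φ (move a b))  ≡⟨ △-solve (φ-move a b) ⟩
        A′ △ pair (f a) (g b) ≡⟨ cong (λ x → A′ △ pair x (g b)) eq ⟩
        A′ △ pair (g b) (g b) ≡⟨ cong (A′ △_) (pair-self (g b)) ⟩
        A′ △ ⊥                ≡⟨ △-identityʳ A′ ⟩
        A′                    ∎)))
        where open ≡-Reasoning

      π-injective : Injective _≡_ _≡_ π
      π-injective {x} {y} eq with side x | side y
      ... | inj₁ x∈ | inj₁ y∈ = cong proj₁ (f-injective eq)
      ... | inj₁ x∈ | inj₂ y∉ = ⊥-elim (f≢g _ _ eq)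
      ... | inj₂ x∉ | inj₁ y∈ = ⊥-elim (f≢g _ _ (sym eq))
      ... | inj₂ x∉ | inj₂ y∉ = cong proj₁ (g-injective eq)

      -- Every pair of vertices is the difference of two sets among A₀ and
      -- its neighbours in the Johnson graph.
      realise : ∀ {u v} → u ≢ v → ∃₂ λ X Y →
        proj₁ X △ proj₁ Y ≡ pair u v × proj₁ (φ X) △ proj₁ (φ Y) ≡ pair (π u) (π v)
      realise {u} {v} u≢v with side u | side v
      ... | inj₁ u∈ | inj₂ v∉ =
        A₀ , move (u , u∈) (v , v∉) , △-involutive A _ , φ-move (u , u∈) (v , v∉)
      ... | inj₂ u∉ | inj₁ v∈ =
        A₀ , move (v , v∈) (u , u∉) , trans (△-involutive A _) (pair-comm v u) ,
        trans (φ-move (v , v∈) (u , u∉)) (pair-comm _ _)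
      ... | inj₁ u∈ | inj₁ v∈ =
        move (u , u∈) b₀ , move (v , v∈) b₀ ,
        trans (△-translate A _ _) (pair△pairʳ u v (proj₁ b₀)) ,
        trans (cong₂ _△_ (△-solve (φ-move _ b₀)) (△-solve (φ-move _ b₀)))
          (trans (△-translate A′ _ _) (pair△pairʳ _ _ (g b₀)))
      ... | inj₂ u∉ | inj₂ v∉ =
        move a₀ (u , u∉) , move a₀ (v , v∉) ,
        trans (△-translate A _ _) (pair△pairˡ (proj₁ a₀) u v) ,
        trans (cong₂ _△_ (△-solve (φ-move a₀ _)) (△-solve (φ-move a₀ _)))
          (trans (△-translate A′ _ _) (pair△pairˡ (f a₀) _ _))

      -- Adjacency of tokens depends only on the symmetric difference, and `realise` matches the
      -- differences on the two sides of `iso`.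
      π-preserves : ∀ u v → Adj G u v ⇔ Adj H (π u) (π v)
      π-preserves u v with u ≟ v
      ... | yes refl = mk⇔ (λ uu → ⊥-elim (irrefl G refl uu)) (λ uu → ⊥-elim (irrefl H refl uu))
      ... | no u≢v with realise u≢v
      ...   | X , Y , XY , φXY = mk⇔
        (λ uv → edge⇒adj H (u≢v ∘ π-injective) φXY
          (Equivalence.to (preserve iso X Y) (adj⇒edge G uv XY)))
        (λ uv → edge⇒adj G u≢v XY
          (Equivalence.from (preserve iso X Y) (adj⇒edge H uv φXY)))

    aligned⇒≅ : G ≅ H
    aligned⇒≅ = record { bij = injective⇒↔ π π-injective ; preserve = π-preserves }

  -- Straight and crossed grids

  private
    elements : ∀ {l} → l ℕ.≤ k → Σ (Fin l → In) λ f → Injective _≡_ _≡_ f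
    elements l≤k with enumerate A (subst (_ ℕ.≤_) (sym (proj₂ A₀)) l≤k)
    ... | f , f-inj , f∈ = (λ i → f i , f∈ i) , λ eq → f-inj (cong proj₁ eq)

    ∣∁∣ : {B : KSubset n k} → ∣ ∁ (proj₁ B) ∣ ≡ n ℕ.∸ k
    ∣∁∣ {B} = trans (∣∁p∣≡n∸∣p∣ (proj₁ B)) (cong (n ℕ.∸_) (proj₂ B))

    ∁-∈ : ∀ {B : Subset n} {x} → lookup B x ≡ false → lookup (∁ B) x ≡ true
    ∁-∈ {B} {x} eq = trans (lookup-map x not B) (cong not eq)

    ∁-∈⁻¹ : ∀ {B : Subset n} {x} → lookup (∁ B) x ≡ true → lookup B x ≡ false
    ∁-∈⁻¹ {B} {x} eq = Bool.not-injective (trans (sym (lookup-map x not B)) eq)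

    coelements : ∀ {l} → l ℕ.≤ n ℕ.∸ k → Σ (Fin l → Out) λ f → Injective _≡_ _≡_ f
    coelements l≤n∸k with enumerate (∁ A) (subst (_ ℕ.≤_) (sym (∣∁∣ {A₀})) l≤n∸k)
    ... | f , f-inj , f∈ = (λ i → f i , ∁-∈⁻¹ {A} (f∈ i)) , λ eq → f-inj (cong proj₁ eq)

    1≤n∸k : 1 ℕ.≤ n ℕ.∸ k
    1≤n∸k = ℕ.m<n⇒0<n∸m k<n

    a₀ : In
    a₀ = proj₁ (elements 1≤k) zero

    b₀ : Out
    b₀ = proj₁ (coelements 1≤n∸k) zero

    straight⇒≅ : Straight r s → G ≅ H
    straight⇒≅ (rows , columns) = aligned⇒≅ a₀ b₀ (λ a → r a b₀) (s a₀) λ a b →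
      trans (image-△ a b) (cong₂ pair (rows a b b₀) (columns a a₀ b))

    -- Here `s` depends only on the removed vertex, so it takes the role of `f`, and `pair-comm`
    -- restores the order.
    crossed⇒≅ : Straight s r → G ≅ H
    crossed⇒≅ (rows , columns) = aligned⇒≅ a₀ b₀ (λ a → s a b₀) (r a₀) λ a b →
      trans (image-△ a b) (trans (pair-comm (r a b) (s a b))
        (cong₂ pair (rows a b b₀) (columns a a₀ b)))

    distinct : {X : Set} {f : Fin 2 → X} → Injective _≡_ _≡_ f → f 0F ≢ f 1F
    distinct f-inj eq with () ← f-inj eq

    -- A one-row grid offers no two rows to `straight`, but now `A` and `A′` each have one element.
    -- `cosingletons` is the same for the complements.
    singletons : k ≡ 1 → Straight r s
    singletons refl =
      (λ a b b′ → ∣∣≡1⇒unique A′ (proj₂ (φ A₀)) (r∈A′ a b) (r∈A′ a b′)) ,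
      (λ a a′ b → cong (λ a → s a b) (el-≡ (∣∣≡1⇒unique A (proj₂ A₀) (proj₂ a) (proj₂ a′))))

    cosingletons : n ℕ.∸ k ≡ 1 → Straight r s
    cosingletons eq =
      (λ a b b′ → cong (r a) (el-≡
        (∣∣≡1⇒unique (∁ A) (trans (∣∁∣ {A₀}) eq) (∁-∈ {A} (proj₂ b)) (∁-∈ {A} (proj₂ b′))))) ,
      (λ a a′ b → ∣∣≡1⇒unique (∁ A′) (trans (∣∁∣ {φ A₀}) eq)
        (∁-∈ {A′} (s∉A′ a b)) (∁-∈ {A′} (s∉A′ a′ b)))

    grid⇒≅ : (a : Fin 2 → In) → Injective _≡_ _≡_ a →
             (b : Fin 2 → Out) → Injective _≡_ _≡_ b → G ≅ H
    grid⇒≅ a a-inj b b-inj = decide (r (a 0F) (b 0F) ≟ r (a 0F) (b 1F))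
      where
      decide : Dec (r (a 0F) (b 0F) ≡ r (a 0F) (b 1F)) → G ≅ H
      decide (yes row) = straight⇒≅
        (straight el-≟ el-≟ r s lines unlines (distinct a-inj) (distinct b-inj) row)
      -- The two cells share a line in the image; as `r` differs, `s` agrees, and `straight` applies
      -- with the roles of `r` and `s` exchanged.
      decide (no ¬row) = crossed⇒≅
        (straight el-≟ el-≟ s r (Sum.swap ∘ lines) (unlines ∘ Sum.swap)
          (distinct a-inj) (distinct b-inj)
          (Sum.fromInj₂ (⊥-elim ∘ ¬row) (lines {a 0F} {a 0F} {b 0F} {b 1F} (inj₁ refl))))

  token-reconstruction : G ≅ H
  token-reconstruction =
    [ (λ 2≤k → [ (λ 2≤n∸k → grid⇒≅ _ (proj₂ (elements 2≤k)) _ (proj₂ (coelements 2≤n∸k)))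
               , straight⇒≅ ∘ cosingletons ∘ sym ]′ (ℕ.m≤n⇒m<n∨m≡n 1≤n∸k))
    , straight⇒≅ ∘ singletons ∘ sym ]′ (ℕ.m≤n⇒m<n∨m≡n 1≤k)

-- The number of vertices

-- The term added by Pascal's rule is `binom n (k - 1)`, positive because `k - 1` is at most `n`.
binom-<-suc : ∀ n k → 1 ℕ.≤ k → k ℕ.≤ suc n → binom n k ℕ.< binom (suc n) k
binom-<-suc n (suc k) _ (s≤s k≤n) = ℕ.m<n+m _ (binom>0 n k k≤n)

binom-mono-< : ∀ {m n} k → 1 ℕ.≤ k → k ℕ.≤ m → m ℕ.< n → binom m k ℕ.< binom n k
binom-mono-< {m} {suc n} k 1≤k k≤m (s≤s m≤n) with ℕ.m≤n⇒m<n∨m≡n m≤n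
... | inj₁ m<n  = ℕ.<-trans (binom-mono-< k 1≤k k≤m m<n)
                    (binom-<-suc n k 1≤k (ℕ.≤-trans k≤m (ℕ.m≤n⇒m≤1+n m≤n)))
... | inj₂ refl = binom-<-suc m k 1≤k (ℕ.m≤n⇒m≤1+n k≤m)

binom-injective : ∀ {m n} k → 1 ℕ.≤ k → k ℕ.≤ m → k ℕ.≤ n → binom m k ≡ binom n k → m ≡ n
binom-injective {m} {n} k 1≤k k≤m k≤n eq with ℕ.<-cmp m n
... | tri< m<n _ _ = ⊥-elim (ℕ.<⇒≢ (binom-mono-< k 1≤k k≤m m<n) eq)
... | tri≈ _ m≡n _ = m≡n
... | tri> _ _ n<m = ⊥-elim (ℕ.<⇒≢ (binom-mono-< k 1≤k k≤n n<m) (sym eq))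

rich⇒TRC : {G : Graph (Fin n)} → Rich G → SatisfiesTRC G
rich⇒TRC {n} rich k 1≤k k<n m H k<m iso
  with refl ← binom-injective k 1≤k (ℕ.<⇒≤ k<n) (ℕ.<⇒≤ k<m) (↔⇒≡
         (↔-trans (↔-sym (KSubset↔Fin n k)) (↔-trans (bij iso) (KSubset↔Fin m k))))
  = token-reconstruction rich 1≤k k<n iso

-- Expectations

indicator : {P : Set p} → Dec P → ℚ
indicator P? = if does P? then 1ℚ else 0ℚ

expect : Dist X → (X → ℚ) → ℚ
expect d f = foldr (λ (p , x) s → p * f x + s) 0ℚ d

module _ {X : Set a} where

  expect-cong : (d : Dist X) {f g : X → ℚ} → (∀ x → f x ≡ g x) → expect d f ≡ expect d g
  expect-cong []            f≗g = refl
  expect-cong ((p , x) ∷ d) f≗g = cong₂ _+_ (cong (p *_) (f≗g x)) (expect-cong d f≗g)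

  expect-+ : (d : Dist X) (f g : X → ℚ) → expect d (λ x → f x + g x) ≡ expect d f + expect d g
  expect-+ []            f g = refl
  expect-+ ((p , x) ∷ d) f g = trans (cong (λ s → p * (f x + g x) + s) (expect-+ d f g))
    (solve 5 (λ p x y s t → p :* (x :+ y) :+ (s :+ t) := (p :* x :+ s) :+ (p :* y :+ t)) refl
      p (f x) (g x) (expect d f) (expect d g))
    where open ℚ-Solver

  expect-* : (d : Dist X) (c : ℚ) (f : X → ℚ) → expect d (λ x → c * f x) ≡ c * expect d f
  expect-* []            c f = sym (ℚ.*-zeroʳ c)
  expect-* ((p , x) ∷ d) c f = trans (cong (λ s → p * (c * f x) + s) (expect-* d c f))
    (solve 4 (λ p c x s → p :* (c :* x) :+ c :* s := c :* (p :* x :+ s)) refl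
      p c (f x) (expect d f))
    where open ℚ-Solver

  expect-0 : (d : Dist X) → expect d (λ _ → 0ℚ) ≡ 0ℚ
  expect-0 d = trans (expect-* d 0ℚ (λ _ → 0ℚ)) (ℚ.*-zeroˡ (expect d (λ _ → 0ℚ)))

  expect-++ : (d e : Dist X) (f : X → ℚ) → expect (d ++ e) f ≡ expect d f + expect e f
  expect-++ []            e f = sym (ℚ.+-identityˡ _)
  expect-++ ((p , x) ∷ d) e f =
    trans (cong (p * f x +_) (expect-++ d e f)) (sym (ℚ.+-assoc (p * f x) _ _))

  expect-sum : (d : Dist X) (f : Fin n → X → ℚ) →
               expect d (λ x → sum (λ i → f i x)) ≡ sum (λ i → expect d (f i))
  expect-sum {n = zero}  d f = expect-0 d
  expect-sum {n = suc n} d f = trans (expect-+ d (f zero) (λ x → sum (λ i → f (suc i) x)))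
    (cong (expect d (f zero) +_) (expect-sum d (f ∘ suc)))

  Pr≡expect : (d : Dist X) {P : Pred X p} (P? : Decidable₁ P) →
              Pr d P? ≡ expect d (indicator ∘ P?)
  Pr≡expect []            P? = refl
  Pr≡expect ((p , x) ∷ d) P? with does (P? x)
  ... | true  = cong₂ _+_ (sym (ℚ.*-identityʳ p)) (Pr≡expect d P?)
  ... | false = trans (Pr≡expect d P?)
    (sym (trans (cong (_+ _) (ℚ.*-zeroʳ p)) (ℚ.+-identityˡ _)))

expect-map : (g : X → Y) (d : Dist X) (f : Y → ℚ) → expect (mapDist g d) f ≡ expect d (f ∘ g)
expect-map g []            f = refl
expect-map g ((p , x) ∷ d) f = cong (p * f (g x) +_) (expect-map g d f)

expect-⊗ : (d : Dist X) (e : Dist Y) (f : X × Y → ℚ) →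
           expect (d ⊗ e) f ≡ expect d λ x → expect e λ y → f (x , y)
expect-⊗ []            e f = refl
expect-⊗ ((p , x) ∷ d) e f =
  trans (expect-++ (List.map _ e) (d ⊗ e) f) (cong₂ _+_ (scale e) (expect-⊗ d e f))
  where
  scale : ∀ e → expect (List.map (λ (q , y) → p * q , (x , y)) e) f ≡
                p * expect e (λ y → f (x , y))
  scale []            = sym (ℚ.*-zeroʳ p)
  scale ((q , y) ∷ e) = trans (cong (λ s → p * q * f (x , y) + s) (scale e))
    (solve 4 (λ p q z s → (p :* q) :* z :+ p :* s := p :* (q :* z :+ s)) refl p q (f (x , y)) _)
    where open ℚ-Solver

-- Fubini; it allows averaging over the first row of bits while the remaining rows are held fixed.
expect-swap : (d : Dist X) (e : Dist Y) (f : X → Y → ℚ) →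
              expect d (λ x → expect e (f x)) ≡ expect e (λ y → expect d (λ x → f x y))
expect-swap []            e f = sym (expect-0 e)
expect-swap ((p , x) ∷ d) e f = sym (trans
  (expect-+ e (λ y → p * f x y) (λ y → expect d (λ x → f x y)))
  (cong₂ _+_ (expect-* e p (f x)) (sym (expect-swap d e f))))

-- Nonnegativity of the weights appears as monotonicity of the expectation, a form that passes
-- directly through `mapDist` and `⊗`.
record IsProbability {X : Set a} (d : Dist X) : Set a where
  field
    mono  : {f g : X → ℚ} → (∀ x → f x ≤ g x) → expect d f ≤ expect d g
    total : expect d (λ _ → 1ℚ) ≡ 1ℚ

  const : (c : ℚ) → expect d (λ _ → c) ≡ c
  const c = begin
    expect d (λ _ → c)        ≡⟨ expect-cong d (λ _ → sym (ℚ.*-identityʳ c)) ⟩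
    expect d (λ _ → c * 1ℚ)   ≡⟨ expect-* d c (λ _ → 1ℚ) ⟩
    c * expect d (λ _ → 1ℚ)   ≡⟨ cong (c *_) total ⟩
    c * 1ℚ                    ≡⟨ ℚ.*-identityʳ c ⟩
    c                         ∎
    where open ≡-Reasoning

open IsProbability

isProbability-map : {d : Dist X} (g : X → Y) → IsProbability d → IsProbability (mapDist g d)
isProbability-map {d = d} g pd = record
  { mono  = λ {f} {h} f≤h → subst₂ _≤_ (sym (expect-map g d f)) (sym (expect-map g d h))
              (mono pd (f≤h ∘ g))
  ; total = trans (expect-map g d _) (total pd)
  }

isProbability-⊗ : {d : Dist X} {e : Dist Y} → IsProbability d → IsProbability e →
                  IsProbability (d ⊗ e)
isProbability-⊗ {d = d} {e} pd pe = record
  { mono  = λ {f} {g} f≤g → subst₂ _≤_ (sym (expect-⊗ d e f)) (sym (expect-⊗ d e g))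
              (mono pd λ x → mono pe λ y → f≤g (x , y))
  ; total = trans (expect-⊗ d e _) (trans (expect-cong d (λ _ → total pe)) (total pd))
  }

isProbability-point : (x : X) → IsProbability ((1ℚ , x) ∷ [])
isProbability-point x = record
  { mono  = λ f≤g → ℚ.+-monoˡ-≤ 0ℚ (ℚ.*-monoˡ-≤-nonNeg 1ℚ (f≤g x))
  ; total = refl
  }

isProbability-fairCoin : IsProbability fairCoin
isProbability-fairCoin = record
  { mono  = λ f≤g → ℚ.+-mono-≤ (ℚ.*-monoˡ-≤-nonNeg ½ (f≤g true))
              (ℚ.+-monoˡ-≤ 0ℚ (ℚ.*-monoˡ-≤-nonNeg ½ (f≤g false)))
  ; total = refl
  }

isProbability-fairCoins : ∀ n → IsProbability (fairCoins n)
isProbability-fairCoins zero    = isProbability-point []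
isProbability-fairCoins (suc n) =
  isProbability-map _ (isProbability-⊗ isProbability-fairCoin (isProbability-fairCoins n))

isProbability-fairEdgeBits : ∀ n → IsProbability (fairEdgeBits n)
isProbability-fairEdgeBits zero    = isProbability-point []
isProbability-fairEdgeBits (suc n) =
  isProbability-map _ (isProbability-⊗ (isProbability-fairCoins n) (isProbability-fairEdgeBits n))

expect-coins : ∀ n (f : Vec Bool (suc n) → ℚ) → expect (fairCoins (suc n)) f ≡
  ½ * expect (fairCoins n) (f ∘ (true ∷_)) + ½ * expect (fairCoins n) (f ∘ (false ∷_))
expect-coins n f = trans (expect-map (uncurry _∷_) (fairCoin ⊗ fairCoins n) f)
  (trans (expect-⊗ fairCoin (fairCoins n) (f ∘ uncurry _∷_))
    (cong (½ * expect (fairCoins n) (f ∘ (true ∷_)) +_)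
      (ℚ.+-identityʳ (½ * expect (fairCoins n) (f ∘ (false ∷_))))))

expect-edgeBits : ∀ n (f : EdgeBits (suc n) → ℚ) → expect (fairEdgeBits (suc n)) f ≡
  expect (fairCoins n) λ row → expect (fairEdgeBits n) λ ω → f (row ∷ ω)
expect-edgeBits n f = trans (expect-map (uncurry _∷_) (fairCoins n ⊗ fairEdgeBits n) f)
  (expect-⊗ (fairCoins n) (fairEdgeBits n) (f ∘ uncurry _∷_))

-- Codegrees in the random graph

¾ ⅞ : ℚ
¾ = ℤ.+ 3 / 4
⅞ = ℤ.+ 7 / 8

½+½ : ∀ x → ½ * x + ½ * x ≡ x
½+½ x = trans (sym (ℚ.*-distribʳ-+ x ½ ½)) (ℚ.*-identityˡ x)

-- The mean of a factor that is `p` or 1 with equal chance; for `p` equal to `½` and `¾` the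
-- coefficient evaluates to `¾` and `⅞`.
average : ∀ p x → ½ * (p * x) + ½ * x ≡ (½ * p + ½) * x
average p x =
  trans (cong (_+ ½ * x) (sym (ℚ.*-assoc ½ p x))) (sym (ℚ.*-distribʳ-+ x (½ * p) ½))

-- Each element of `m` independently contributes a factor `½` or 1, which is `¾` on average.
expect-½^ : (m : Subset n) → expect (fairCoins n) (λ row → ½ ^ ∣ row ∩ m ∣) ≡ ¾ ^ ∣ m ∣
expect-½^ [] = refl
expect-½^ {suc n} (true ∷ m) = begin
  expect (fairCoins (suc n)) (λ row → ½ ^ ∣ row ∩ (true ∷ m) ∣)
    ≡⟨ expect-coins n (λ row → ½ ^ ∣ row ∩ (true ∷ m) ∣) ⟩
  ½ * expect (fairCoins n) (λ row → ½ * ½ ^ ∣ row ∩ m ∣) +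
  ½ * expect (fairCoins n) (λ row → ½ ^ ∣ row ∩ m ∣)
    ≡⟨ cong (λ x → ½ * x + ½ * E) (expect-* (fairCoins n) ½ _) ⟩
  ½ * (½ * E) + ½ * E
    ≡⟨ average ½ E ⟩
  ¾ * E
    ≡⟨ cong (¾ *_) (expect-½^ m) ⟩
  ¾ * ¾ ^ ∣ m ∣ ∎
  where
  open ≡-Reasoning
  E = expect (fairCoins n) (λ row → ½ ^ ∣ row ∩ m ∣)
expect-½^ {suc n} (false ∷ m) = begin
  expect (fairCoins (suc n)) (λ row → ½ ^ ∣ row ∩ (false ∷ m) ∣)
    ≡⟨ expect-coins n (λ row → ½ ^ ∣ row ∩ (false ∷ m) ∣) ⟩
  ½ * E + ½ * E
    ≡⟨ ½+½ E ⟩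
  E
    ≡⟨ expect-½^ m ⟩
  ¾ ^ ∣ m ∣ ∎
  where
  open ≡-Reasoning
  E = expect (fairCoins n) (λ row → ½ ^ ∣ row ∩ m ∣)

expect-¾^ : ∀ n → expect (fairCoins n) (λ row → ¾ ^ ∣ row ∣) ≡ ⅞ ^ n
expect-¾^ zero    = refl
expect-¾^ (suc n) = begin
  expect (fairCoins (suc n)) (λ row → ¾ ^ ∣ row ∣)
    ≡⟨ expect-coins n (λ row → ¾ ^ ∣ row ∣) ⟩
  ½ * expect (fairCoins n) (λ row → ¾ * ¾ ^ ∣ row ∣) + ½ * E
    ≡⟨ cong (λ x → ½ * x + ½ * E) (expect-* (fairCoins n) ¾ _) ⟩
  ½ * (¾ * E) + ½ * E
    ≡⟨ average ¾ E ⟩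
  ⅞ * E
    ≡⟨ cong (⅞ *_) (expect-¾^ n) ⟩
  ⅞ * ⅞ ^ n ∎
  where
  open ≡-Reasoning
  E = expect (fairCoins n) (λ row → ¾ ^ ∣ row ∣)

expect-lookup : (j : Fin n) (h : Bool → ℚ) →
                expect (fairCoins n) (λ row → h (lookup row j)) ≡ ½ * h true + ½ * h false
expect-lookup {suc n} zero h = trans (expect-coins n (λ row → h (lookup row zero)))
  (cong₂ (λ x y → ½ * x + ½ * y) (const (isProbability-fairCoins n) (h true))
                                 (const (isProbability-fairCoins n) (h false)))
expect-lookup {suc n} (suc j) h = trans (expect-coins n (λ row → h (lookup row (suc j))))
  (trans (½+½ _) (expect-lookup j h))

-- The value stays nested, one bit after the other, so that `average` can be applied twice, first
-- with `½` and then with `¾`.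
expect-lookup₂ : {i j : Fin n} → i ≢ j → (h : Bool → ℚ) →
                 expect (fairCoins n) (λ row → h (lookup row i ∧ lookup row j)) ≡
                 ½ * (½ * h true + ½ * h false) + ½ * h false
expect-lookup₂ {suc n} {zero}  {zero}  i≢j h = ⊥-elim (i≢j refl)
expect-lookup₂ {suc n} {zero}  {suc j} i≢j h =
  trans (expect-coins n (λ row → h (lookup row zero ∧ lookup row (suc j))))
    (cong₂ (λ x y → ½ * x + ½ * y) (expect-lookup j h)
                                   (const (isProbability-fairCoins n) (h false)))
expect-lookup₂ {suc n} {suc i} {zero}  i≢j h = trans
  (expect-cong (fairCoins (suc n)) λ row →
    cong h (Bool.∧-comm (lookup row (suc i)) (lookup row zero)))
  (expect-lookup₂ (i≢j ∘ sym) h)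
expect-lookup₂ {suc n} {suc i} {suc j} i≢j h =
  trans (expect-coins n (λ row → h (lookup row (suc i) ∧ lookup row (suc j))))
    (trans (½+½ _) (expect-lookup₂ (i≢j ∘ cong suc) h))

neighbours : EdgeBits n → Fin n → Subset n
neighbours (row ∷ ω) zero    = false ∷ row
neighbours (row ∷ ω) (suc i) = lookup row i ∷ neighbours ω i

lookup-neighbours : (ω : EdgeBits n) → ∀ i j → lookup (neighbours ω i) j ≡ bit ω i j
lookup-neighbours (row ∷ ω) zero    zero    = refl
lookup-neighbours (row ∷ ω) zero    (suc j) = refl
lookup-neighbours (row ∷ ω) (suc i) zero    = refl
lookup-neighbours (row ∷ ω) (suc i) (suc j) = lookup-neighbours ω i j

codegree : EdgeBits n → Fin n → Fin n → ℕ
codegree ω i j = ∣ neighbours ω i ∩ neighbours ω j ∣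

-- Each of the `n - 1` other vertices contributes a factor `⅞` on average. The extra `⅞` on the left
-- avoids the subtraction.
expect-¾^degree : (j : Fin n) →
  ⅞ * expect (fairEdgeBits n) (λ ω → ¾ ^ ∣ neighbours ω j ∣) ≡ ⅞ ^ n
expect-¾^degree {suc n} zero = cong (⅞ *_) (begin
  expect (fairEdgeBits (suc n)) (λ ω → ¾ ^ ∣ neighbours ω zero ∣)
    ≡⟨ expect-edgeBits n (λ ω → ¾ ^ ∣ neighbours ω zero ∣) ⟩
  expect (fairCoins n) (λ row → expect (fairEdgeBits n) λ _ → ¾ ^ ∣ row ∣)
    ≡⟨ expect-cong (fairCoins n) (λ row → const (isProbability-fairEdgeBits n) (¾ ^ ∣ row ∣)) ⟩
  expect (fairCoins n) (λ row → ¾ ^ ∣ row ∣)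
    ≡⟨ expect-¾^ n ⟩
  ⅞ ^ n ∎)
  where open ≡-Reasoning
expect-¾^degree {suc n} (suc j) = cong (⅞ *_) (begin
  expect (fairEdgeBits (suc n)) (λ ω → ¾ ^ ∣ neighbours ω (suc j) ∣)
    ≡⟨ expect-edgeBits n (λ ω → ¾ ^ ∣ neighbours ω (suc j) ∣) ⟩
  expect (fairCoins n) (λ row → expect (fairEdgeBits n) λ ω → ¾ ^ ∣ lookup row j ∷ neighbours ω j ∣)
    ≡⟨ expect-swap (fairCoins n) (fairEdgeBits n) _ ⟩
  expect (fairEdgeBits n) (λ ω → expect (fairCoins n) λ row → ¾ ^ ∣ lookup row j ∷ neighbours ω j ∣)
    ≡⟨ expect-cong (fairEdgeBits n) (λ ω →
         trans (expect-lookup j (λ b → ¾ ^ ∣ b ∷ neighbours ω j ∣))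
               (average ¾ (¾ ^ ∣ neighbours ω j ∣))) ⟩
  expect (fairEdgeBits n) (λ ω → ⅞ * ¾ ^ ∣ neighbours ω j ∣)
    ≡⟨ expect-* (fairEdgeBits n) ⅞ _ ⟩
  ⅞ * expect (fairEdgeBits n) (λ ω → ¾ ^ ∣ neighbours ω j ∣)
    ≡⟨ expect-¾^degree j ⟩
  ⅞ ^ n ∎)
  where open ≡-Reasoning

-- Each of the `n - 2` other vertices is a common neighbour with probability 1/4 and so contributes
-- `⅞`; the two extra factors avoid the subtraction. The induction peels off vertex `zero`; once it
-- is `i` or `j` itself, its free row is averaged against the fixed neighbourhood of the other
-- vertex.
expect-½^codegree : {i j : Fin n} → i ≢ j →
  ⅞ * (⅞ * expect (fairEdgeBits n) (λ ω → ½ ^ codegree ω i j)) ≡ ⅞ ^ n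
expect-½^codegree {suc n} {zero} {zero} i≢j = ⊥-elim (i≢j refl)
expect-½^codegree {suc n} {zero} {suc j} i≢j = cong (⅞ *_) (begin
  ⅞ * expect (fairEdgeBits (suc n)) (λ ω → ½ ^ codegree ω zero (suc j))
    ≡⟨ cong (⅞ *_) (expect-edgeBits n (λ ω → ½ ^ codegree ω zero (suc j))) ⟩
  ⅞ * expect (fairCoins n) (λ row → expect (fairEdgeBits n) λ ω → ½ ^ ∣ row ∩ neighbours ω j ∣)
    ≡⟨ cong (⅞ *_) (expect-swap (fairCoins n) (fairEdgeBits n) _) ⟩
  ⅞ * expect (fairEdgeBits n) (λ ω → expect (fairCoins n) λ row → ½ ^ ∣ row ∩ neighbours ω j ∣)
    ≡⟨ cong (⅞ *_) (expect-cong (fairEdgeBits n) λ ω → expect-½^ (neighbours ω j)) ⟩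
  ⅞ * expect (fairEdgeBits n) (λ ω → ¾ ^ ∣ neighbours ω j ∣)
    ≡⟨ expect-¾^degree j ⟩
  ⅞ ^ n ∎)
  where open ≡-Reasoning
expect-½^codegree {suc n} {suc i} {zero} i≢j = trans
  (cong (λ x → ⅞ * (⅞ * x)) (expect-cong (fairEdgeBits (suc n)) λ ω →
    cong (λ S → ½ ^ ∣ S ∣) (∩-comm (neighbours ω (suc i)) (neighbours ω zero))))
  (expect-½^codegree (i≢j ∘ sym))
expect-½^codegree {suc n} {suc i} {suc j} i≢j = cong (⅞ *_) (begin
  ⅞ * expect (fairEdgeBits (suc n)) (λ ω → ½ ^ codegree ω (suc i) (suc j))
    ≡⟨ cong (⅞ *_) (expect-edgeBits n (λ ω → ½ ^ codegree ω (suc i) (suc j))) ⟩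
  ⅞ * expect (fairCoins n) (λ row → expect (fairEdgeBits n) λ ω →
    ½ ^ ∣ (lookup row i ∧ lookup row j) ∷ (neighbours ω i ∩ neighbours ω j) ∣)
    ≡⟨ cong (⅞ *_) (expect-swap (fairCoins n) (fairEdgeBits n) _) ⟩
  ⅞ * expect (fairEdgeBits n) (λ ω → expect (fairCoins n) λ row →
    ½ ^ ∣ (lookup row i ∧ lookup row j) ∷ (neighbours ω i ∩ neighbours ω j) ∣)
    ≡⟨ cong (⅞ *_) (expect-cong (fairEdgeBits n) λ ω → trans
         (expect-lookup₂ (i≢j ∘ cong suc) (λ b → ½ ^ ∣ b ∷ (neighbours ω i ∩ neighbours ω j) ∣))
         (trans (cong (λ x → ½ * x + ½ * ½ ^ codegree ω i j) (average ½ (½ ^ codegree ω i j)))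
                (average ¾ (½ ^ codegree ω i j)))) ⟩
  ⅞ * expect (fairEdgeBits n) (λ ω → ⅞ * ½ ^ codegree ω i j)
    ≡⟨ cong (⅞ *_) (expect-* (fairEdgeBits n) ⅞ _) ⟩
  ⅞ * (⅞ * expect (fairEdgeBits n) (λ ω → ½ ^ codegree ω i j))
    ≡⟨ expect-½^codegree (i≢j ∘ cong suc) ⟩
  ⅞ ^ n ∎)
  where open ≡-Reasoning

codegree⇒rich : (ω : EdgeBits n) → (∀ {i j} → i ≢ j → 5 ℕ.≤ codegree ω i j) → Rich (toGraph ω)
codegree⇒rich ω large {i} {j} i≢j
  with f , f-inj , f∈ ← enumerate (neighbours ω i ∩ neighbours ω j) (large i≢j) =
  f , f-inj , λ l → adjacent i (f l) (∧-trueˡ (both l)) , adjacent j (f l) (∧-trueʳ (both l))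
  where
  both : ∀ l → lookup (neighbours ω i) (f l) ∧ lookup (neighbours ω j) (f l) ≡ true
  both l = trans (sym (lookup-zipWith _∧_ (f l) (neighbours ω i) (neighbours ω j))) (f∈ l)
  ∧-trueˡ : ∀ {a b} → a ∧ b ≡ true → a ≡ true
  ∧-trueˡ {true} _ = refl
  ∧-trueʳ : ∀ {a b} → a ∧ b ≡ true → b ≡ true
  ∧-trueʳ {true} eq = eq
  adjacent : ∀ u v → lookup (neighbours ω u) v ≡ true → T (bit ω u v)
  adjacent u v eq = subst T (trans (sym eq) (lookup-neighbours ω u v)) tt

-- Markov's inequality

-- The reciprocal of `½ ^ 4`, the least value of `½ ^ c` over codegrees `c` below 5.
16ℚ : ℚ
16ℚ = ℤ.+ 16 / 1

-- Dominates the indicator that `i` and `j` are distinct with fewer than five common neighbours,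
-- while its expectation is a product.
penalty : EdgeBits n → Fin n → Fin n → ℚ
penalty ω i j = if does (i ≟ j) then 0ℚ else 16ℚ * ½ ^ codegree ω i j

0≤^ : ∀ x n → 0ℚ ≤ x → 0ℚ ≤ x ^ n
0≤^ x zero    0≤x = ℚ.≤ᵇ⇒≤ tt
0≤^ x (suc n) 0≤x = subst (_≤ x * x ^ n) (ℚ.*-zeroʳ x)
  (ℚ.*-monoˡ-≤-nonNeg x ⦃ ℚ.nonNegative 0≤x ⦄ (0≤^ x n 0≤x))

0≤penalty : (ω : EdgeBits n) → ∀ i j → 0ℚ ≤ penalty ω i j
0≤penalty ω i j with does (i ≟ j)
... | true  = ℚ.≤-refl
... | false = subst (_≤ 16ℚ * ½ ^ codegree ω i j) (ℚ.*-zeroʳ 16ℚ)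
  (ℚ.*-monoˡ-≤-nonNeg 16ℚ (0≤^ ½ (codegree ω i j) (ℚ.≤ᵇ⇒≤ tt)))

1≤16½^ : ∀ c → c ℕ.< 5 → 1ℚ ≤ 16ℚ * ½ ^ c
1≤16½^ 0 _ = ℚ.≤ᵇ⇒≤ tt
1≤16½^ 1 _ = ℚ.≤ᵇ⇒≤ tt
1≤16½^ 2 _ = ℚ.≤ᵇ⇒≤ tt
1≤16½^ 3 _ = ℚ.≤ᵇ⇒≤ tt
1≤16½^ 4 _ = ℚ.≤ᵇ⇒≤ tt
1≤16½^ (suc (suc (suc (suc (suc c))))) (s≤s (s≤s (s≤s (s≤s (s≤s ())))))

1≤penalty : (ω : EdgeBits n) → ∀ {i j} → i ≢ j → codegree ω i j ℕ.< 5 → 1ℚ ≤ penalty ω i j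
1≤penalty ω {i} {j} i≢j small with i ≟ j
... | yes i≡j = ⊥-elim (i≢j i≡j)
... | no _    = 1≤16½^ _ small

0≤sum : {f : Fin n → ℚ} → (∀ i → 0ℚ ≤ f i) → 0ℚ ≤ sum f
0≤sum {zero}  0≤f = ℚ.≤-refl
0≤sum {suc n} 0≤f = ℚ.+-mono-≤ (0≤f zero) (0≤sum (0≤f ∘ suc))

≤sum : {f : Fin n → ℚ} → (∀ i → 0ℚ ≤ f i) → ∀ i → f i ≤ sum f
≤sum {suc n} {f} 0≤f zero    =
  subst (_≤ sum f) (ℚ.+-identityʳ (f zero)) (ℚ.+-monoʳ-≤ (f zero) (0≤sum (0≤f ∘ suc)))
≤sum {suc n} {f} 0≤f (suc i) =
  subst (_≤ sum f) (ℚ.+-identityˡ (f (suc i))) (ℚ.+-mono-≤ (0≤f zero) (≤sum (0≤f ∘ suc) i))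

-- As a repeated sum, this fits the recursion of `sum`, and its multiplicativity is `×1-homo-*`.
ℕ→ℚ : ℕ → ℚ
ℕ→ℚ n = n ×ℚ 1ℚ

sum≤ : {f : Fin n → ℚ} {c : ℚ} → (∀ i → f i ≤ c) → sum f ≤ ℕ→ℚ n * c
sum≤ {zero}  {c = c} f≤c = ℚ.≤-reflexive (sym (ℚ.*-zeroˡ c))
sum≤ {suc n} {f} {c} f≤c = subst (sum f ≤_)
  (trans (cong (_+ ℕ→ℚ n * c) (sym (ℚ.*-identityˡ c))) (sym (ℚ.*-distribʳ-+ c 1ℚ (ℕ→ℚ n))))
  (ℚ.+-mono-≤ (f≤c zero) (sum≤ (f≤c ∘ suc)))

total-penalty : EdgeBits n → ℚ
total-penalty ω = sum λ i → sum λ j → penalty ω i j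

0≤total-penalty : (ω : EdgeBits n) → 0ℚ ≤ total-penalty ω
0≤total-penalty ω = 0≤sum λ i → 0≤sum (0≤penalty ω i)

indicator≤1 : {P : Set p} (P? : Dec P) → indicator P? ≤ 1ℚ
indicator≤1 (yes _) = ℚ.≤-refl
indicator≤1 (no _)  = ℚ.≤ᵇ⇒≤ tt

-- The pointwise form of Markov's inequality and the union bound: if reconstruction fails, some pair
-- has a small codegree, and its penalty alone is at least 1.
penalised : (ω : EdgeBits n) → 1ℚ ≤ indicator (satisfiesTRC? (toGraph ω)) + total-penalty ω
penalised {n} ω = cases (satisfiesTRC? (toGraph ω))
  where
  cases : (P? : Dec (SatisfiesTRC (toGraph ω))) → 1ℚ ≤ indicator P? + total-penalty ω
  cases (yes _)   = subst (_≤ 1ℚ + total-penalty ω) (ℚ.+-identityʳ 1ℚ)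
    (ℚ.+-monoʳ-≤ 1ℚ (0≤total-penalty ω))
  cases (no ¬TRC)
    with any? (λ i → any? λ j → ¬? (i ≟ j) ×-dec (codegree ω i j ℕ.<? 5))
  ... | no none = ⊥-elim (¬TRC (rich⇒TRC (codegree⇒rich ω λ {i} {j} i≢j →
          ℕ.≮⇒≥ λ small → none (i , j , i≢j , small))))
  ... | yes (i , j , i≢j , small) = subst (1ℚ ≤_) (sym (ℚ.+-identityˡ (total-penalty ω)))
    (ℚ.≤-trans (1≤penalty ω i≢j small) (ℚ.≤-trans (≤sum (0≤penalty ω i) j)
      (≤sum (λ i → 0≤sum (0≤penalty ω i)) i)))

-- Asymptotics

open SemiringMult (CommutativeRing.semiring ℚ.+-*-commutativeRing)
  using () renaming (×1-homo-* to ℕ→ℚ-*)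

toℚᵘ-ℕ→ℚ : ∀ n → ℚ.toℚᵘ (ℕ→ℚ n) ℚᵘ.≃ mkℚᵘ (ℤ.+ n) 0
toℚᵘ-ℕ→ℚ zero    = *≡* refl
toℚᵘ-ℕ→ℚ (suc n) = ℚᵘ.≃-trans (ℚ.toℚᵘ-homo-+ 1ℚ (ℕ→ℚ n))
  (ℚᵘ.≃-trans (ℚᵘ.+-congʳ (ℚ.toℚᵘ 1ℚ) (toℚᵘ-ℕ→ℚ n))
    (*≡* (cong (λ i → (ℤ.+ 1 ℤ.+ i) ℤ.* ℤ.+ 1) (ℤ.*-identityʳ (ℤ.+ n)))))

ℕ→ℚ-mono : ∀ {m n} → m ℕ.≤ n → ℕ→ℚ m ≤ ℕ→ℚ n
ℕ→ℚ-mono {m} {n} m≤n = ℚ.toℚᵘ-cancel-≤ (ℚᵘ.≤-trans (ℚᵘ.≤-reflexive (toℚᵘ-ℕ→ℚ m))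
  (ℚᵘ.≤-trans (*≤* (ℤ.*-monoʳ-≤-nonNeg (ℤ.+ 1) (ℤ.+≤+ m≤n)))
    (ℚᵘ.≤-reflexive (ℚᵘ.≃-sym (toℚᵘ-ℕ→ℚ n)))))

0≤ℕ→ℚ : ∀ n → 0ℚ ≤ ℕ→ℚ n
0≤ℕ→ℚ n = ℕ→ℚ-mono {0} {n} z≤n

-- The denominator is at least 1, so the absolute value of the numerator is a bound.
bounded-by-ℕ : ∀ q → ∃ λ n → q ≤ ℕ→ℚ n
bounded-by-ℕ q@(mkℚ i d _) = ℤ.∣ i ∣ , ℚ.toℚᵘ-cancel-≤
  (ℚᵘ.≤-trans (*≤* (ℤ.≤-trans (ℤ.≤-reflexive (ℤ.*-identityʳ i)) (i≤∣i∣*d i)))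
    (ℚᵘ.≤-reflexive (ℚᵘ.≃-sym (toℚᵘ-ℕ→ℚ ℤ.∣ i ∣))))
  where
  i≤∣i∣*d : ∀ i → i ℤ.≤ ℤ.+ ℤ.∣ i ∣ ℤ.* ℤ.+ suc d
  i≤∣i∣*d (ℤ.+ n)      = subst (ℤ.+ n ℤ.≤_) (ℤ.pos-* n (suc d)) (ℤ.+≤+ (ℕ.m≤m*n n (suc d)))
  i≤∣i∣*d -[1+ n ]   = ℤ.-≤+

*-mono-nonNeg : ∀ {x y z} → 0ℚ ≤ x → y ≤ z → x * y ≤ x * z
*-mono-nonNeg {x} 0≤x = ℚ.*-monoˡ-≤-nonNeg x ⦃ ℚ.nonNegative 0≤x ⦄

archimedean : ∀ {ε} → 0ℚ < ε → ∀ q → ∃ λ n → q ≤ ℕ→ℚ n * ε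
archimedean {ε} 0<ε q =
  let n , q/ε≤n = bounded-by-ℕ (q * ℚ.1/ ε)
  in n , subst (_≤ ℕ→ℚ n * ε) cancel
       (ℚ.*-monoʳ-≤-nonNeg ε ⦃ ℚ.nonNegative (ℚ.<⇒≤ 0<ε) ⦄ q/ε≤n)
  where
  instance ε≢0 = ℚ.pos⇒nonZero ε ⦃ ℚ.positive 0<ε ⦄
  cancel : q * ℚ.1/ ε * ε ≡ q
  cancel = trans (ℚ.*-assoc q (ℚ.1/ ε) ε)
    (trans (cong (q *_) (ℚ.*-inverseˡ ε)) (ℚ.*-identityʳ q))

cube : ℕ → ℕ
cube n = n ℕ.* (n ℕ.* n)

-- 22 is the least n with 7 (n + 1)³ ≤ 8 n³.
cube-ratio : ∀ {n} → 22 ℕ.≤ n → 7 ℕ.* cube (suc n) ℕ.≤ 8 ℕ.* cube n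
cube-ratio {n} 22≤n =
  subst₂ (λ x y → 7 ℕ.* cube x ℕ.≤ 8 ℕ.* cube y) (cong suc 22+m≡n) 22+m≡n (shifted (n ℕ.∸ 22))
  where
  open ℕ-Solver
  22+m≡n : 22 ℕ.+ (n ℕ.∸ 22) ≡ n
  22+m≡n = ℕ.m+[n∸m]≡n 22≤n
  shifted : ∀ m → 7 ℕ.* cube (23 ℕ.+ m) ℕ.≤ 8 ℕ.* cube (22 ℕ.+ m)
  -- With `n = 22 + m`, the difference of the two sides is a polynomial in `m` with nonnegative
  -- coefficients.
  shifted m = ℕ.m+n≤o⇒m≤o (7 ℕ.* cube (23 ℕ.+ m)) (ℕ.≤-reflexive (solve 1 (λ m →
    con 7 :* ((con 23 :+ m) :* ((con 23 :+ m) :* (con 23 :+ m))) :+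
      (con 15 :+ con 507 :* m :+ con 45 :* (m :* m) :+ m :* (m :* m)) :=
    con 8 :* ((con 22 :+ m) :* ((con 22 :+ m) :* (con 22 :+ m)))) refl m))

⅞*≤ : ∀ {x y} → 7 ℕ.* x ℕ.≤ 8 ℕ.* y → ⅞ * ℕ→ℚ x ≤ ℕ→ℚ y
⅞*≤ {x} {y} 7x≤8y = subst₂ _≤_ (scale 7 x) (trans (scale 8 y) (ℚ.*-identityˡ (ℕ→ℚ y)))
  (ℚ.*-monoˡ-≤-nonNeg (ℤ.+ 1 / 8) (ℕ→ℚ-mono 7x≤8y))
  where
  scale : ∀ m x → (ℤ.+ 1 / 8) * ℕ→ℚ (m ℕ.* x) ≡ ((ℤ.+ 1 / 8) * ℕ→ℚ m) * ℕ→ℚ x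
  scale m x = trans (cong ((ℤ.+ 1 / 8) *_) (ℕ→ℚ-* m x))
    (sym (ℚ.*-assoc (ℤ.+ 1 / 8) (ℕ→ℚ m) (ℕ→ℚ x)))

0≤⅞^ : ∀ n → 0ℚ ≤ ⅞ ^ n
0≤⅞^ n = 0≤^ ⅞ n (ℚ.≤ᵇ⇒≤ tt)

-- One power of `n` more than in the bound on the expected penalty, so that boundedness of `cubic`
-- alone makes the penalty of order 1/n.
cubic : ℕ → ℚ
cubic n = ℕ→ℚ (cube n) * ⅞ ^ n

cubic-decreasing : ∀ {n} → 22 ℕ.≤ n → cubic (suc n) ≤ cubic n
cubic-decreasing {n} 22≤n = subst (_≤ cubic n)
  (trans (cong (_* ⅞ ^ n) (ℚ.*-comm ⅞ x)) (ℚ.*-assoc x ⅞ (⅞ ^ n)))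
  (ℚ.*-monoʳ-≤-nonNeg (⅞ ^ n) ⦃ ℚ.nonNegative (0≤⅞^ n) ⦄
    (⅞*≤ {cube (suc n)} {cube n} (cube-ratio 22≤n)))
  where x = ℕ→ℚ (cube (suc n))

cubic-bounded : ∃ λ c → ∀ n → 22 ℕ.≤ n → cubic n ≤ c
cubic-bounded = cubic 22 , λ n 22≤n →
  subst (λ n → cubic n ≤ cubic 22) (ℕ.m∸n+n≡m 22≤n) (descend ℕ.≤-refl (n ℕ.∸ 22))
  where
  descend : ∀ {l} → 22 ℕ.≤ l → ∀ m → cubic (m ℕ.+ l) ≤ cubic l
  descend 22≤l zero    = ℚ.≤-refl
  descend 22≤l (suc m) =
    ℚ.≤-trans (cubic-decreasing (ℕ.≤-trans 22≤l (ℕ.m≤n+m _ m))) (descend 22≤l m)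

-- The factor 16 of `penalty` times the square of 8/7, which turns the exponent `n - 2` into `n`.
8/7 64/49·16 : ℚ
8/7 = ℤ.+ 8 / 7
64/49·16 = 16ℚ * (8/7 * 8/7)

0≤64/49·16 : 0ℚ ≤ 64/49·16
0≤64/49·16 = ℚ.≤ᵇ⇒≤ tt

expect-penalty : (i j : Fin n) →
                 expect (fairEdgeBits n) (λ ω → penalty ω i j) ≤ 64/49·16 * ⅞ ^ n
expect-penalty {n} i j with i ≟ j
... | yes _  = subst₂ _≤_ (sym (expect-0 (fairEdgeBits n))) refl
  (subst (_≤ 64/49·16 * ⅞ ^ n) (ℚ.*-zeroʳ 64/49·16) (*-mono-nonNeg 0≤64/49·16 (0≤⅞^ n)))
... | no i≢j = ℚ.≤-reflexive (begin
  expect (fairEdgeBits n) (λ ω → 16ℚ * ½ ^ codegree ω i j)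
                           ≡⟨ expect-* (fairEdgeBits n) 16ℚ _ ⟩
  16ℚ * E                  ≡⟨ rescale E ⟩
  64/49·16 * (⅞ * (⅞ * E)) ≡⟨ cong (64/49·16 *_) (expect-½^codegree i≢j) ⟩
  64/49·16 * ⅞ ^ n         ∎)
  where
  open ≡-Reasoning
  E = expect (fairEdgeBits n) (λ ω → ½ ^ codegree ω i j)
  rescale : ∀ x → 16ℚ * x ≡ 64/49·16 * (⅞ * (⅞ * x))
  -- The product of `64/49·16` with `⅞ * ⅞` evaluates to `16ℚ`.
  rescale x = sym (trans (cong (64/49·16 *_) (sym (ℚ.*-assoc ⅞ ⅞ x)))
    (sym (ℚ.*-assoc 64/49·16 (⅞ * ⅞) x)))

expect-total-penalty : ∀ n → expect (fairEdgeBits n) total-penalty ≤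
                       ℕ→ℚ n * (ℕ→ℚ n * (64/49·16 * ⅞ ^ n))
expect-total-penalty n =
  subst (_≤ ℕ→ℚ n * (ℕ→ℚ n * bound)) (sym (expect-sum (fairEdgeBits n) (λ i ω → sum (penalty ω i))))
    (sum≤ λ i → subst (_≤ ℕ→ℚ n * bound) (sym (expect-sum (fairEdgeBits n) (λ j ω → penalty ω i j)))
      (sum≤ λ j → expect-penalty i j))
  where bound = 64/49·16 * ⅞ ^ n

n*penalty≤cubic : ∀ n → ℕ→ℚ n * expect (fairEdgeBits n) total-penalty ≤ 64/49·16 * cubic n
n*penalty≤cubic n = subst (ℕ→ℚ n * expect (fairEdgeBits n) total-penalty ≤_)
  (trans (rearrange (ℕ→ℚ n) 64/49·16 (⅞ ^ n))
    (cong (λ x → 64/49·16 * (x * ⅞ ^ n))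
      (sym (trans (ℕ→ℚ-* n (n ℕ.* n)) (cong (ℕ→ℚ n *_) (ℕ→ℚ-* n n))))))
  (*-mono-nonNeg (0≤ℕ→ℚ n) (expect-total-penalty n))
  where
  rearrange : ∀ x c y → x * (x * (x * (c * y))) ≡ c * ((x * (x * x)) * y)
  rearrange = solve 3 (λ x c y → x :* (x :* (x :* (c :* y))) := c :* ((x :* (x :* x)) :* y)) refl
    where open ℚ-Solver

-- Convergence of the probability

Pr-TRC : ∀ n → Pr (randomGraph n) satisfiesTRC? ≡
               expect (fairEdgeBits n) (λ ω → indicator (satisfiesTRC? (toGraph ω)))
Pr-TRC n = trans (Pr≡expect (randomGraph n) satisfiesTRC?)
  (expect-map toGraph (fairEdgeBits n) (λ G → indicator (satisfiesTRC? G)))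

Pr-TRC≤1 : ∀ n → Pr (randomGraph n) satisfiesTRC? ≤ 1ℚ
Pr-TRC≤1 n = subst₂ _≤_ (sym (Pr-TRC n)) (total (isProbability-fairEdgeBits n))
  (mono (isProbability-fairEdgeBits n) λ ω → indicator≤1 (satisfiesTRC? (toGraph ω)))

1≤Pr-TRC+penalty : ∀ n →
  1ℚ ≤ Pr (randomGraph n) satisfiesTRC? + expect (fairEdgeBits n) total-penalty
1≤Pr-TRC+penalty n = subst₂ _≤_ (total (isProbability-fairEdgeBits n))
  (trans (expect-+ (fairEdgeBits n) _ total-penalty)
    (cong (_+ expect (fairEdgeBits n) total-penalty) (sym (Pr-TRC n))))
  (mono (isProbability-fairEdgeBits n) penalised)

∣p-1∣≤ : ∀ {p x} → p ≤ 1ℚ → 1ℚ ≤ p + x → ℚ.∣ p - 1ℚ ∣ ≤ x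
∣p-1∣≤ {p} {x} p≤1 1≤p+x = subst₂ _≤_ (sym abs) cancel (ℚ.+-monoˡ-≤ (ℚ.- p) 1≤p+x)
  where
  open ℚ-Solver
  cancel : p + x - p ≡ x
  cancel = solve 2 (λ p x → p :+ x :- p := x) refl p x
  abs : ℚ.∣ p - 1ℚ ∣ ≡ 1ℚ - p
  abs = trans (cong ℚ.∣_∣ (solve 1 (λ p → p :- con 1ℚ := :- (con 1ℚ :- p)) refl p))
    (trans (ℚ.∣-p∣≡∣p∣ (1ℚ - p))
      (ℚ.0≤p⇒∣p∣≡p (subst (_≤ 1ℚ - p) (ℚ.+-inverseʳ p) (ℚ.+-monoˡ-≤ (ℚ.- p) p≤1))))

penalty-vanishes : ∀ {ε} → 0ℚ < ε →
  ∃ λ N → ∀ n → N ℕ.≤ n → expect (fairEdgeBits n) total-penalty < ε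
penalty-vanishes {ε} 0<ε =
  let c , cubic≤c = cubic-bounded
      -- `N` makes `N * ε` exceed the bound on `n` times the expected penalty, with the added 1
      -- giving strictness. The threshold `22 + N` also reaches the range where `cubic` is bounded.
      N , large   = archimedean 0<ε (64/49·16 * c + 1ℚ)
  in 22 ℕ.+ N , λ n N≤n → ℚ.≰⇒> λ ε≤X → ℚ.<-irrefl refl (begin-strict
    64/49·16 * c                                  <⟨ <+1 (64/49·16 * c) ⟩
    64/49·16 * c + 1ℚ                             ≤⟨ large ⟩
    ℕ→ℚ N * ε                                     ≤⟨ *ε-mono (ℕ.≤-trans (ℕ.m≤n+m N 22) N≤n) ⟩
    ℕ→ℚ n * ε                                     ≤⟨ *-mono-nonNeg (0≤ℕ→ℚ n) ε≤X ⟩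
    ℕ→ℚ n * expect (fairEdgeBits n) total-penalty ≤⟨ n*penalty≤cubic n ⟩
    64/49·16 * cubic n                            ≤⟨ *-mono-nonNeg 0≤64/49·16
                                                       (cubic≤c n (ℕ.≤-trans (ℕ.m≤m+n 22 N) N≤n)) ⟩
    64/49·16 * c                                  ∎)
  where
  open ℚ.≤-Reasoning
  <+1 : ∀ x → x < x + 1ℚ
  <+1 x = subst (_< x + 1ℚ) (ℚ.+-identityʳ x) (ℚ.+-monoʳ-< x (ℚ.positive⁻¹ 1ℚ))
  *ε-mono : ∀ {m n} → m ℕ.≤ n → ℕ→ℚ m * ε ≤ ℕ→ℚ n * ε
  *ε-mono m≤n = ℚ.*-monoʳ-≤-nonNeg ε ⦃ ℚ.nonNegative (ℚ.<⇒≤ 0<ε) ⦄ (ℕ→ℚ-mono m≤n)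

mainTheorem1 : TendsTo (λ n → Pr (randomGraph n) satisfiesTRC?) 1ℚ
mainTheorem1 ε 0<ε =
  let N , small = penalty-vanishes 0<ε
  in N , λ n N≤n →
    ℚ.≤-<-trans (∣p-1∣≤ (Pr-TRC≤1 n) (1≤Pr-TRC+penalty n)) (small n N≤n)
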